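{- Let $q$ be a power of an odd prime, let $d\geq 2$ be an integer, let $t\in\mathbb{F}_q^{*}$ and let $\mathcal{A}\subseteq\mathbb{F}_q$. Then \[ N_d(\mathcal{A};t)=(1+o(1))\frac{|\mathcal{A}|^{d^2}}{q} \] provided $|\mathcal{A}|=\omega\left(q^{\frac{d}{2d-1}}+q^{\frac{d^2-d+4}{2(d^2-d+2)}}\right)$.
   Context: $\mathbb{F}_q$ is the finite field with $q$ elements. For a set $\mathcal{A}\subseteq\mathbb{F}_q$ and $t\in\mathbb{F}_q$, $N_d(\mathcal{A};t)$ denotes the number of $d\times d$ matrices with all entries in $\mathcal{A}$ whose determinant equals $t$. Asymptotic notation refers to $q\to\infty$ with $d$ fixed; implied constants may depend on $d$. $U=O(V)$ means $|U|\le cV$ for some constant $c>0$; $U=\Omega(V)$ means $U\ge c|V|$ for some constant $c>0$; $U=\omega(V)$ means $U=\Omega(V)$ but not $U=O(V)$, i.e. $U/V\to\infty$; $o(1)$ denotes a quantity tending to $0$. -}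

module Defs where

open import Data.Nat as ℕ using (ℕ; zero; suc)
open import Data.Fin using (Fin; zero; suc; punchIn)
open import Data.Fin.Properties using () renaming (_≟_ to _≟F_)
open import Data.Bool using (Bool; true; false; _∧_)
open import Data.List using (allFin; foldr; List; []; _∷_; map; concatMap; length; filterᵇ; tabulate)
open import Data.Product using (Σ)
open import Data.Vec.Functional using () renaming (_∷_ to _∷ᶠ_; [] to []ᶠ)
open import Function.Bundles using (_↔_; Inverse)
open import Relation.Binary.PropositionalEquality using (_≡_; refl; cong; sym; trans)
open import Relation.Nullary using (¬_; Dec; yes; no)
open import Relation.Nullary.Decidable using (⌊_⌋)
open import Algebra.Structures using (IsCommutativeRing)

record FiniteField : Set₁ where
  infixl 6 _+_
  infixl 7 _*_
  field
    Carrier : Set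
    _+_ _*_ : Carrier → Carrier → Carrier
    -_      : Carrier → Carrier
    0# 1#   : Carrier
    isCommutativeRing : IsCommutativeRing _≡_ _+_ _*_ -_ 0# 1#
    0≢1     : ¬ (0# ≡ 1#)
    inverse : (x : Carrier) → ¬ (x ≡ 0#) → Σ Carrier (λ y → x * y ≡ 1#)
    size    : ℕ
    enum    : Carrier ↔ Fin size

  _≟_ : (x y : Carrier) → Dec (x ≡ y)
  x ≟ y with Inverse.to enum x ≟F Inverse.to enum y
  ... | yes p = yes (trans (sym (Inverse.strictlyInverseʳ enum x)) (trans (cong (Inverse.from enum) p) (Inverse.strictlyInverseʳ enum y)))
  ... | no ¬p = no (λ e → ¬p (cong (Inverse.to enum) e))

  elements : List Carrier
  elements = tabulate (Inverse.from enum)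

  -- odd characteristic (for a finite field: q is a power of an odd prime)
  OddCharacteristic : Set
  OddCharacteristic = ¬ (1# + 1# ≡ 0#)

  sumFin : (n : ℕ) → (Fin n → Carrier) → Carrier
  sumFin zero    f = 0#
  sumFin (suc n) f = f zero + sumFin n (λ i → f (suc i))

  sign : {n : ℕ} → Fin n → Carrier
  sign zero    = 1#
  sign (suc i) = - sign i

  det : (n : ℕ) → (Fin n → Fin n → Carrier) → Carrier
  det zero    M = 1#
  det (suc n) M =
    sumFin (suc n) (λ i → sign i * (M i zero * det n (λ r c → M (punchIn i r) (suc c))))

  allFuns : {X : Set} → List X → (n : ℕ) → List (Fin n → X)
  allFuns xs zero    = []ᶠ ∷ []
  allFuns xs (suc n) = concatMap (λ x → map (λ f → x ∷ᶠ f) (allFuns xs n)) xs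

  allMatrices : (d : ℕ) → List (Fin d → Fin d → Carrier)
  allMatrices d = allFuns (allFuns elements d) d

  -- a subset A ⊆ F_q is given by its (Boolean) indicator function
  card : (Carrier → Bool) → ℕ
  card A = length (filterᵇ A elements)

  allB : {X : Set} → (X → Bool) → List X → Bool
  allB p = foldr (λ x b → p x ∧ b) true

  allEntriesIn : (A : Carrier → Bool) (d : ℕ) → (Fin d → Fin d → Carrier) → Bool
  allEntriesIn A d M = allB (λ i → allB (λ j → A (M i j)) (allFin d)) (allFin d)

  N : (d : ℕ) → (A : Carrier → Bool) → Carrier → ℕ
  N d A t = length (filterᵇ (λ M → allEntriesIn A d M ∧ ⌊ det d M ≟ t ⌋) (allMatrices d))

open FiniteField public using (Carrier; 0#; 1#; size; OddCharacteristic; card; N; det; elements)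

{-# OPTIONS --safe #-}
module Submission where

-- Split off the first column a of M and let P be the minor obtained by deleting
-- the first row and column.  Then det M = a·y, where y is the vector of cofactors
-- of the remaining columns, with y₀ = det P; matrices with det P = 0 contribute
-- little.  For fixed t ≠ 0 the hyperplanes a·y = t through distinct y are pairwise
-- almost independent in a, so the variance of #{y : a·y = t} over a ∈ 𝔽ᵈ is at
-- most q^(d+1) times the number of pairs with equal y.  By orthogonality of
-- cofactors to columns, y and P determine the deleted row, hence the number of
-- pairs is at most |A|^(d-1) ∑_{t≠0} N_{d-1}(t)².  Summing the same variance over
-- t, after the rescaling a ↦ t a, gives a recursion for ∑_{t≠0} N_d(t)², whose
-- solution has exactly the two thresholds on |A| of the theorem.

open import Defs
open import Data.Nat using (ℕ; zero; suc; _+_; _*_; _∸_; _^_; _≤_; _<_; z≤n; s≤s; ∣_-_∣; NonZero; >-nonZero; >-nonZero⁻¹)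
open import Data.Bool using (Bool; true; false; _∧_; not; if_then_else_)
open import Data.Product using (∃-syntax; Σ; _,_; _×_; proj₁; proj₂)
open import Relation.Binary.PropositionalEquality
open import Relation.Nullary using (¬_; yes; no)
open import Relation.Nullary.Decidable using (⌊_⌋)
open import Data.Nat.Properties hiding (_≟_)
open import Data.Nat.Tactic.RingSolver using (solve-∀) renaming (solve to solveℕ)
open import Data.Fin using (Fin; zero; suc; punchIn)
open import Data.Fin.Properties using (toℕ<n)
open import Data.Vec.Functional using () renaming (_∷_ to _∷ᶠ_)
open import Data.List using (List; []; _∷_; _++_; allFin; concatMap; filterᵇ; length; map; tabulate)
open import Data.List.Properties using (length-tabulate)
open import Data.List.Membership.Propositional using (_∈_)
open import Data.List.Relation.Unary.Any using (here; there)
open import Data.Sum using (_⊎_; inj₁; inj₂)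
open import Data.Empty using (⊥-elim)
open import Function.Bundles using (Inverse)
open import Algebra.Bundles using (CommutativeRing)
open import Level using (0ℓ)
import Algebra.Solver.Ring.NaturalCoefficients.Default as NaturalSolver
import Algebra.Properties.Ring as RingProperties

-- For t = 0 the variance argument breaks down: a·y = 0 depends on y only up to a scalar, so
-- proportional cofactor vectors give the same hyperplane. Hence the second moment runs over nonzero
-- determinants only, and N_n(0), where n = d - 1, gets its own bound n V/|A| with V = |A|^(n²).
-- Bounding ∑_{t≠0} N_n(t)² by maximum times total yields V²/|A|, whereas equidistribution predicts
-- V²/q. The rescaling narrows this gap: enlarging Aᵈ to 𝔽ᵈ separately for each t costs about q
-- variances, dilation only |A|. The recursion then gives, up to a constant, V²/q + q^(n(n-1)/2)
-- |A|^(n-1) V. The squared error for N_d is q^(n+2) |A|^(2n+1) times this and must be small against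
-- |A|^(2d²). For the first term that means q^d small against |A|^(2d-1), for the second
-- q^((d²-d+4)/2) small against |A|^(d²-d+2). Everything is stated in ℕ: averages are multiplied by
-- q, and smallness of x against y reads M * x ≤ y.

variable
  X Y : Set

-- Sums over lists and inequalities for squares

∑ : List X → (X → ℕ) → ℕ
∑ []       f = 0
∑ (x ∷ xs) f = f x + ∑ xs f

infixr 8 ∑
syntax ∑ l (λ x → e) = ∑[ x ∈ l ] e

⟦_⟧ : Bool → ℕ
⟦ b ⟧ = if b then 1 else 0

∑-cong : (l : List X) {f g : X → ℕ} → (∀ x → f x ≡ g x) → ∑ l f ≡ ∑ l g
∑-cong []      e = refl
∑-cong (x ∷ l) e = cong₂ _+_ (e x) (∑-cong l e)

∑-mono-∈ : (l : List X) {f g : X → ℕ} → (∀ {x} → x ∈ l → f x ≤ g x) → ∑ l f ≤ ∑ l g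
∑-mono-∈ []      e = z≤n
∑-mono-∈ (x ∷ l) e = +-mono-≤ (e (here refl)) (∑-mono-∈ l (λ i → e (there i)))

∑-cong-∈ : (l : List X) {f g : X → ℕ} → (∀ {x} → x ∈ l → f x ≡ g x) → ∑ l f ≡ ∑ l g
∑-cong-∈ []      e = refl
∑-cong-∈ (x ∷ l) e = cong₂ _+_ (e (here refl)) (∑-cong-∈ l (λ i → e (there i)))

∑-mono : (l : List X) {f g : X → ℕ} → (∀ x → f x ≤ g x) → ∑ l f ≤ ∑ l g
∑-mono l e = ∑-mono-∈ l (λ {x} _ → e x)

+-interchange : ∀ a b c d → a + b + (c + d) ≡ a + c + (b + d)
+-interchange = solve-∀

∑-+ : (l : List X) (f g : X → ℕ) → ∑[ x ∈ l ] (f x + g x) ≡ ∑ l f + ∑ l g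
∑-+ []      f g = refl
∑-+ (x ∷ l) f g rewrite ∑-+ l f g = +-interchange (f x) (g x) (∑ l f) (∑ l g)

∑-*ˡ : (l : List X) (k : ℕ) (f : X → ℕ) → ∑[ x ∈ l ] (k * f x) ≡ k * ∑ l f
∑-*ˡ []      k f = sym (*-zeroʳ k)
∑-*ˡ (x ∷ l) k f rewrite ∑-*ˡ l k f = sym (*-distribˡ-+ k (f x) (∑ l f))

∑-*ʳ : (l : List X) (k : ℕ) (f : X → ℕ) → ∑[ x ∈ l ] (f x * k) ≡ ∑ l f * k
∑-*ʳ []      k f = refl
∑-*ʳ (x ∷ l) k f rewrite ∑-*ʳ l k f = sym (*-distribʳ-+ k (f x) (∑ l f))

∑-const : (l : List X) (k : ℕ) → ∑[ _ ∈ l ] k ≡ length l * k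
∑-const []      k = refl
∑-const (x ∷ l) k = cong (k +_) (∑-const l k)

∑-one : (l : List X) → ∑[ _ ∈ l ] 1 ≡ length l
∑-one l = trans (∑-const l 1) (*-identityʳ (length l))

∑-swap : (l : List X) (l′ : List Y) (f : X → Y → ℕ) →
         ∑[ x ∈ l ] ∑[ y ∈ l′ ] f x y ≡ ∑[ y ∈ l′ ] ∑[ x ∈ l ] f x y
∑-swap []      l′ f = sym (trans (∑-const l′ 0) (*-zeroʳ (length l′)))
∑-swap (x ∷ l) l′ f = trans (cong (∑ l′ (f x) +_) (∑-swap l l′ f)) (sym (∑-+ l′ (f x) _))

∑-product : (l : List X) (l′ : List Y) (f : X → ℕ) (g : Y → ℕ) →
            ∑ l f * ∑ l′ g ≡ ∑[ x ∈ l ] ∑[ y ∈ l′ ] (f x * g y)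
∑-product l l′ f g = trans (sym (∑-*ʳ l (∑ l′ g) f)) (∑-cong l (λ x → sym (∑-*ˡ l′ (f x) g)))

∑-++ : (l l′ : List X) (f : X → ℕ) → ∑ (l ++ l′) f ≡ ∑ l f + ∑ l′ f
∑-++ []      l′ f = refl
∑-++ (x ∷ l) l′ f = trans (cong (f x +_) (∑-++ l l′ f)) (sym (+-assoc (f x) _ _))

∑-map : (h : X → Y) (l : List X) (f : Y → ℕ) → ∑ (map h l) f ≡ ∑[ x ∈ l ] f (h x)
∑-map h []      f = refl
∑-map h (x ∷ l) f = cong (f (h x) +_) (∑-map h l f)

∑-concatMap : (h : X → List Y) (l : List X) (f : Y → ℕ) → ∑ (concatMap h l) f ≡ ∑[ x ∈ l ] ∑ (h x) f
∑-concatMap h []      f = refl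
∑-concatMap h (x ∷ l) f = trans (∑-++ (h x) (concatMap h l) f) (cong (∑ (h x) f +_) (∑-concatMap h l f))

∑-filter : (p : X → Bool) (l : List X) (f : X → ℕ) → ∑ (filterᵇ p l) f ≡ ∑[ x ∈ l ] (⟦ p x ⟧ * f x)
∑-filter p []      f = refl
∑-filter p (x ∷ l) f with p x
... | true  = cong₂ _+_ (sym (+-identityʳ (f x))) (∑-filter p l f)
... | false = ∑-filter p l f

∑-filter-≤ : (p : X → Bool) (l : List X) (f : X → ℕ) → ∑ (filterᵇ p l) f ≤ ∑ l f
∑-filter-≤ p []      f = z≤n
∑-filter-≤ p (x ∷ l) f with p x
... | true  = +-monoʳ-≤ (f x) (∑-filter-≤ p l f)
... | false = ≤-trans (∑-filter-≤ p l f) (m≤n+m _ (f x))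

∑-partition : (p : X → Bool) (l : List X) (f : X → ℕ) →
              ∑ l f ≡ ∑ (filterᵇ (λ x → not (p x)) l) f + ∑ (filterᵇ p l) f
∑-partition p []      f = refl
∑-partition p (x ∷ l) f with p x | ∑-partition p l f
... | true  | e = trans (cong (f x +_) e) (swap (f x) (∑ (filterᵇ (λ x → not (p x)) l) f) _)
  where
  swap : ∀ a b c → a + (b + c) ≡ b + (a + c)
  swap = solve-∀
... | false | e = trans (cong (f x +_) e) (sym (+-assoc (f x) _ _))

∈-filterᵇ : (p : X → Bool) (l : List X) {x : X} → x ∈ filterᵇ p l → p x ≡ true
∈-filterᵇ p (y ∷ l) i with p y in eq
∈-filterᵇ p (y ∷ l) (here refl) | true  = eq
∈-filterᵇ p (y ∷ l) (there i)   | true  = ∈-filterᵇ p l i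
∈-filterᵇ p (y ∷ l) i           | false = ∈-filterᵇ p l i

length-filter : (p : X → Bool) (l : List X) → length (filterᵇ p l) ≡ ∑[ x ∈ l ] ⟦ p x ⟧
length-filter p []      = refl
length-filter p (x ∷ l) with p x
... | true  = cong suc (length-filter p l)
... | false = length-filter p l

-- The list `elements` tabulates a bijection; this lemma turns that into the fact that each field
-- element is listed once.
∑-tabulate-single : ∀ {n} (h : Fin n → X) (f : X → ℕ) (k : Fin n) → f (h k) ≡ 1 →
                    (∀ i → ¬ (i ≡ k) → f (h i) ≡ 0) → ∑ (tabulate h) f ≡ 1
∑-tabulate-single h f zero e e′ = cong₂ _+_ e (zeros (λ i → h (suc i)) (λ i → e′ (suc i) λ ()))
  where
  zeros : ∀ {n} (g : Fin n → _) → (∀ i → f (g i) ≡ 0) → ∑ (tabulate g) f ≡ 0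
  zeros {zero}  g z = refl
  zeros {suc n} g z = cong₂ _+_ (z zero) (zeros (λ i → g (suc i)) (λ i → z (suc i)))
∑-tabulate-single h f (suc k) e e′ =
  cong₂ _+_ (e′ zero λ ()) (∑-tabulate-single (λ i → h (suc i)) f k e (λ i i≢k → e′ (suc i) (λ { refl → i≢k refl })))

-- The square of a difference, with the cross term on the left so that no truncated subtraction
-- occurs.
dist-square : ∀ m n → ∣ m - n ∣ * ∣ m - n ∣ + 2 * (m * n) ≡ m * m + n * n
dist-square m n with ≤-total m n
... | inj₁ m≤n with m≤n⇒∃[o]m+o≡n m≤n
...   | k , refl rewrite ∣m-m+n∣≡n m k = solveℕ (m ∷ k ∷ [])
dist-square m n | inj₂ n≤m with m≤n⇒∃[o]m+o≡n n≤m
...   | k , refl rewrite ∣-∣-comm (n + k) n | ∣m-m+n∣≡n n k = solveℕ (n ∷ k ∷ [])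

dist-+ : ∀ a b c d → ∣ a + b - c + d ∣ ≤ ∣ a - c ∣ + ∣ b - d ∣
dist-+ a b c d = begin
  ∣ a + b - c + d ∣                       ≤⟨ ∣-∣-triangle (a + b) (c + b) (c + d) ⟩
  ∣ a + b - c + b ∣ + ∣ c + b - c + d ∣   ≡⟨ cong₂ _+_ (trans (cong₂ ∣_-_∣ (+-comm a b) (+-comm c b)) (∣m+n-m+o∣≡∣n-o∣ b a c)) (∣m+n-m+o∣≡∣n-o∣ c b d) ⟩
  ∣ a - c ∣ + ∣ b - d ∣                   ∎
  where open ≤-Reasoning

∑-dist : (l : List X) (f g : X → ℕ) → ∣ ∑ l f - ∑ l g ∣ ≤ ∑[ x ∈ l ] ∣ f x - g x ∣
∑-dist []      f g = z≤n
∑-dist (x ∷ l) f g = ≤-trans (dist-+ (f x) _ (g x) _) (+-monoʳ-≤ ∣ f x - g x ∣ (∑-dist l f g))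

2mn≤m²+n² : ∀ m n → 2 * (m * n) ≤ m * m + n * n
2mn≤m²+n² m n = ≤-trans (m≤n+m _ (∣ m - n ∣ * ∣ m - n ∣)) (≤-reflexive (dist-square m n))

-- Induction on the list: the cross terms between head and tail are absorbed by 2ab ≤ a² + b².
cauchy-schwarz : (l : List X) (f : X → ℕ) → ∑ l f * ∑ l f ≤ length l * ∑[ x ∈ l ] (f x * f x)
cauchy-schwarz []      f = z≤n
cauchy-schwarz (x ∷ l) f = begin
  (f x + s) * (f x + s)                     ≡⟨ expand (f x) s ⟩
  f x * f x + 2 * (f x * s) + s * s         ≤⟨ +-mono-≤ (+-monoʳ-≤ (f x * f x) cross) (cauchy-schwarz l f) ⟩
  f x * f x + (n * (f x * f x) + Q) + n * Q ≡⟨ collect (f x * f x) n Q ⟩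
  suc n * (f x * f x + Q)                   ∎
  where
  open ≤-Reasoning
  s n Q : ℕ
  s = ∑ l f
  n = length l
  Q = ∑[ y ∈ l ] (f y * f y)
  expand : ∀ a b → (a + b) * (a + b) ≡ a * a + 2 * (a * b) + b * b
  expand = solve-∀
  collect : ∀ a n b → a + (n * a + b) + n * b ≡ (1 + n) * (a + b)
  collect = solve-∀
  cross : 2 * (f x * s) ≤ n * (f x * f x) + Q
  cross = begin
    2 * (f x * s)                         ≡⟨ sym (trans (∑-*ˡ l 2 _) (cong (2 *_) (∑-*ˡ l (f x) f))) ⟩
    ∑[ y ∈ l ] (2 * (f x * f y))          ≤⟨ ∑-mono l (λ y → 2mn≤m²+n² (f x) (f y)) ⟩
    ∑[ y ∈ l ] (f x * f x + f y * f y)    ≡⟨ trans (∑-+ l _ _) (cong (_+ Q) (∑-const l _)) ⟩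
    n * (f x * f x) + Q                   ∎

square-+ : ∀ m n → (m + n) * (m + n) ≤ 2 * (m * m) + 2 * (n * n)
square-+ m n = begin
  (m + n) * (m + n)               ≡⟨ solveℕ (m ∷ n ∷ []) ⟩
  2 * (m * n) + (m * m + n * n)   ≤⟨ +-monoˡ-≤ _ (2mn≤m²+n² m n) ⟩
  (m * m + n * n) + (m * m + n * n) ≡⟨ solveℕ (m ∷ n ∷ []) ⟩
  2 * (m * m) + 2 * (n * n)       ∎
  where open ≤-Reasoning

square-mono⁻¹ : ∀ {m n} → m * m ≤ n * n → m ≤ n
square-mono⁻¹ {m} {n} le = ≮⇒≥ (λ n<m → <⇒≱ (*-mono-< n<m n<m) le)

^-distribʳ-* : ∀ a b n → (a * b) ^ n ≡ a ^ n * b ^ n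
^-distribʳ-* a b zero    = refl
^-distribʳ-* a b (suc n) = trans (cong (a * b *_) (^-distribʳ-* a b n)) (*-interchange a b (a ^ n) (b ^ n))
  where
  *-interchange : ∀ a b c d → a * b * (c * d) ≡ a * c * (b * d)
  *-interchange = solve-∀

-- Cofactors and their orthogonality to columns

module Field (F : FiniteField) where
  open FiniteField F public
    hiding (OddCharacteristic; card; N)
    renaming (Carrier to 𝕂; 0# to 𝟘; 1# to 𝟙; _+_ to infixl 6 _⊕_; _*_ to infixl 7 _⊗_; -_ to ⊖_; size to q; det to Det; elements to 𝔽)

  commutativeRing : CommutativeRing 0ℓ 0ℓ
  commutativeRing = record { isCommutativeRing = isCommutativeRing }

  module R = CommutativeRing commutativeRing
  module RP = RingProperties R.ring
  open NaturalSolver R.commutativeSemiring using (solve; _:+_; _:*_; _:=_; con)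

  ⊗-cancelʳ : ∀ {x x′ y} → ¬ (y ≡ 𝟘) → x ⊗ y ≡ x′ ⊗ y → x ≡ x′
  ⊗-cancelʳ {x} {x′} {y} y≢0 e with inverse y y≢0
  ... | z , yz≡1 = trans (undo x) (trans (cong (_⊗ z) e) (sym (undo x′)))
    where
    undo : ∀ u → u ≡ u ⊗ y ⊗ z
    undo u = sym (trans (R.*-assoc u y z) (trans (cong (u ⊗_) yz≡1) (R.*-identityʳ u)))

  ⊗-zero-cancelʳ : ∀ {x y} → ¬ (y ≡ 𝟘) → x ⊗ y ≡ 𝟘 → x ≡ 𝟘
  ⊗-zero-cancelʳ {x} {y} y≢0 e = ⊗-cancelʳ y≢0 (trans e (sym (R.zeroˡ y)))

  ⊕-cancelʳ : ∀ x {y z} → y ⊕ x ≡ z ⊕ x → y ≡ z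
  ⊕-cancelʳ x {y} {z} = RP.+-cancelʳ x y z

  sumFin-cong : ∀ n {f g : Fin n → 𝕂} → (∀ i → f i ≡ g i) → sumFin n f ≡ sumFin n g
  sumFin-cong zero    e = refl
  sumFin-cong (suc n) e = cong₂ _⊕_ (e zero) (sumFin-cong n (λ i → e (suc i)))

  sumFin-⊕ : ∀ n (f g : Fin n → 𝕂) → sumFin n (λ i → f i ⊕ g i) ≡ sumFin n f ⊕ sumFin n g
  sumFin-⊕ zero    f g = sym (R.+-identityˡ 𝟘)
  sumFin-⊕ (suc n) f g rewrite sumFin-⊕ n (λ i → f (suc i)) (λ i → g (suc i)) =
    solve 4 (λ a b c d → a :+ b :+ (c :+ d) := a :+ c :+ (b :+ d)) refl (f zero) (g zero) _ _

  sumFin-⊗ : ∀ n k (f : Fin n → 𝕂) → sumFin n (λ i → k ⊗ f i) ≡ k ⊗ sumFin n f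
  sumFin-⊗ zero    k f = sym (R.zeroʳ k)
  sumFin-⊗ (suc n) k f rewrite sumFin-⊗ n k (λ i → f (suc i)) = sym (R.distribˡ k _ _)

  sumFin-⊖ : ∀ n (f : Fin n → 𝕂) → sumFin n (λ i → ⊖ f i) ≡ ⊖ sumFin n f
  sumFin-⊖ zero    f = sym RP.-0#≈0#
  sumFin-⊖ (suc n) f rewrite sumFin-⊖ n (λ i → f (suc i)) = RP.-‿+-comm _ _

  sumFin-zero : ∀ n (f : Fin n → 𝕂) → (∀ i → f i ≡ 𝟘) → sumFin n f ≡ 𝟘
  sumFin-zero zero    f e = refl
  sumFin-zero (suc n) f e = trans (cong₂ _⊕_ (e zero) (sumFin-zero n _ (λ i → e (suc i)))) (R.+-identityˡ 𝟘)

  Det-cong : ∀ n {M M′ : Fin n → Fin n → 𝕂} → (∀ i j → M i j ≡ M′ i j) → Det n M ≡ Det n M′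
  Det-cong zero    e = refl
  Det-cong (suc n) e = sumFin-cong (suc n) λ i →
    cong (sign i ⊗_) (cong₂ _⊗_ (e i zero) (Det-cong n (λ r c → e (punchIn i r) (suc c))))

  dot : ∀ {n} → (Fin n → 𝕂) → (Fin n → 𝕂) → 𝕂
  dot {n} a y = sumFin n (λ i → a i ⊗ y i)

  dot-cong : ∀ {n} {a a′ y y′ : Fin n → 𝕂} → (∀ i → a i ≡ a′ i) → (∀ i → y i ≡ y′ i) → dot a y ≡ dot a′ y′
  dot-cong {n} e e′ = sumFin-cong n (λ i → cong₂ _⊗_ (e i) (e′ i))

  -- The generalised cross product of the n columns: the signed maximal minors, which are the
  -- Laplace coefficients of a column added in front.
  cofactors : ∀ {n} → (Fin (suc n) → Fin n → 𝕂) → Fin (suc n) → 𝕂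
  cofactors {n} M i = sign i ⊗ Det n (λ r → M (punchIn i r))

  Det-dot : ∀ {n} (a : Fin (suc n) → 𝕂) (M : Fin (suc n) → Fin n → 𝕂) →
            Det (suc n) (λ i → a i ∷ᶠ M i) ≡ dot a (cofactors M)
  Det-dot {n} a M = sumFin-cong (suc n) λ i →
    solve 3 (λ s a d → s :* (a :* d) := a :* (s :* d)) refl (sign i) (a i) (Det n (λ r → M (punchIn i r)))

  -- Double Laplace expansion along columns u and v, where D stands for the
  -- minor on the rows remaining after two deletions.
  pairSum : ∀ n (u v : Fin (suc (suc n)) → 𝕂) → ((Fin n → Fin (suc (suc n))) → 𝕂) → 𝕂
  pairSum n u v D = sumFin (suc (suc n)) λ i → sign i ⊗ (u i ⊗ sumFin (suc n) λ k →
    sign k ⊗ (v (punchIn i k) ⊗ D (λ r → punchIn i (punchIn k r))))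

  -- Minors are indexed by row selections. Selections built along different routes agree only
  -- pointwise, and D must not see the difference.
  Extensional : ∀ {n m} → ((Fin n → Fin m) → 𝕂) → Set
  Extensional D = ∀ {f g} → (∀ r → f r ≡ g r) → D f ≡ D g

  private
    crossTerm : ∀ n (u v : Fin (suc (suc n)) → 𝕂) → ((Fin n → Fin (suc (suc n))) → 𝕂) → 𝕂
    crossTerm n u v D = u zero ⊗ sumFin (suc n) λ k → sign k ⊗ (v (suc k) ⊗ D (λ r → suc (punchIn k r)))

    restTerm : ∀ n (u v : Fin (suc (suc n)) → 𝕂) → ((Fin n → Fin (suc (suc n))) → 𝕂) → 𝕂
    restTerm n u v D = sumFin (suc n) λ i → sign i ⊗ (u (suc i) ⊗ sumFin n λ k →
      sign k ⊗ (v (suc (punchIn i k)) ⊗ D (λ r → punchIn (suc i) (punchIn (suc k) r))))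

    neg-distrib : ∀ s u v e X → ⊖ s ⊗ (u ⊗ (𝟙 ⊗ (v ⊗ e) ⊕ ⊖ X)) ≡ ⊖ (v ⊗ (s ⊗ (u ⊗ e))) ⊕ s ⊗ (u ⊗ X)
    neg-distrib s u v e X = begin
      ⊖ s ⊗ (u ⊗ (𝟙 ⊗ (v ⊗ e) ⊕ ⊖ X))
        ≡⟨ solve 5 (λ s u v e X → s :* (u :* (con 1 :* (v :* e) :+ X)) := v :* (s :* (u :* e)) :+ s :* (u :* X)) refl (⊖ s) u v e (⊖ X) ⟩
      v ⊗ (⊖ s ⊗ (u ⊗ e)) ⊕ ⊖ s ⊗ (u ⊗ ⊖ X)
        ≡⟨ cong₂ _⊕_ (trans (cong (v ⊗_) (sym (RP.-‿distribˡ-* s (u ⊗ e)))) (sym (RP.-‿distribʳ-* v _)))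
             (trans (sym (RP.-‿distribˡ-* s _)) (trans (cong (λ z → ⊖ (s ⊗ z)) (sym (RP.-‿distribʳ-* u X)))
               (trans (cong ⊖_ (sym (RP.-‿distribʳ-* s (u ⊗ X)))) (RP.-‿involutive _)))) ⟩
      ⊖ (v ⊗ (s ⊗ (u ⊗ e))) ⊕ s ⊗ (u ⊗ X) ∎
      where open ≡-Reasoning

    -- Row zero is taken by u, by v, or by neither. A column that takes a lower row while row zero
    -- is still present contributes one sign flip: one flip when v takes row zero, two when neither
    -- does.
    pairSum-split : ∀ n u v D → pairSum n u v D ≡ crossTerm n u v D ⊕ (⊖ crossTerm n v u D ⊕ restTerm n u v D)
    pairSum-split n u v D = cong₂ _⊕_ (R.*-identityˡ _) (begin
      sumFin (suc n) (λ i → ⊖ sign i ⊗ (u (suc i) ⊗ (𝟙 ⊗ (v zero ⊗ e i) ⊕ sumFin n (λ k → ⊖ sign k ⊗ (g i k)))))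
        ≡⟨ sumFin-cong (suc n) (λ i → trans
             (cong (λ z → ⊖ sign i ⊗ (u (suc i) ⊗ (𝟙 ⊗ (v zero ⊗ e i) ⊕ z)))
               (trans (sumFin-cong n (λ k → sym (RP.-‿distribˡ-* (sign k) (g i k)))) (sumFin-⊖ n _)))
             (neg-distrib (sign i) (u (suc i)) (v zero) (e i) _)) ⟩
      sumFin (suc n) (λ i → ⊖ (v zero ⊗ (sign i ⊗ (u (suc i) ⊗ e i))) ⊕ sign i ⊗ (u (suc i) ⊗ sumFin n (λ k → sign k ⊗ g i k)))
        ≡⟨ sumFin-⊕ (suc n) (λ i → ⊖ (v zero ⊗ t i)) (λ i → sign i ⊗ (u (suc i) ⊗ sumFin n (λ k → sign k ⊗ g i k))) ⟩
      sumFin (suc n) (λ i → ⊖ (v zero ⊗ (sign i ⊗ (u (suc i) ⊗ e i)))) ⊕ restTerm n u v D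
        ≡⟨ cong (_⊕ restTerm n u v D) (trans (sumFin-⊖ (suc n) (λ i → v zero ⊗ t i)) (cong ⊖_ (sumFin-⊗ (suc n) (v zero) t))) ⟩
      ⊖ crossTerm n v u D ⊕ restTerm n u v D ∎)
      where
      open ≡-Reasoning
      e : Fin (suc n) → 𝕂
      e i = D (λ r → suc (punchIn i r))
      t : Fin (suc n) → 𝕂
      t i = sign i ⊗ (u (suc i) ⊗ e i)
      g : Fin (suc n) → Fin n → 𝕂
      g i k = v (suc (punchIn i k)) ⊗ D (λ r → punchIn (suc i) (punchIn (suc k) r))

  mutual
    -- Exchanging u and v makes the two cross terms trade places with opposite signs; the rest is
    -- the same claim in one dimension less.
    pairSum-antisym : ∀ n u v D → Extensional D → pairSum n u v D ⊕ pairSum n v u D ≡ 𝟘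
    pairSum-antisym n u v D ext = begin
      pairSum n u v D ⊕ pairSum n v u D
        ≡⟨ cong₂ _⊕_ (pairSum-split n u v D) (pairSum-split n v u D) ⟩
      (α ⊕ (⊖ β ⊕ γ)) ⊕ (β ⊕ (⊖ α ⊕ γ′))
        ≡⟨ solve 6 (λ a b c b′ a′ c′ → a :+ (b′ :+ c) :+ (b :+ (a′ :+ c′)) := (a :+ a′) :+ (b :+ b′) :+ (c :+ c′))
             refl α β γ (⊖ β) (⊖ α) γ′ ⟩
      (α ⊕ ⊖ α) ⊕ (β ⊕ ⊖ β) ⊕ (γ ⊕ γ′)
        ≡⟨ cong₂ _⊕_ (trans (cong₂ _⊕_ (R.-‿inverseʳ α) (R.-‿inverseʳ β)) (R.+-identityˡ 𝟘)) (restTerm-antisym n u v D ext) ⟩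
      𝟘 ⊕ 𝟘 ≡⟨ R.+-identityˡ 𝟘 ⟩
      𝟘 ∎
      where
      open ≡-Reasoning
      α β γ γ′ : 𝕂
      α = crossTerm n u v D
      β = crossTerm n v u D
      γ = restTerm n u v D
      γ′ = restTerm n v u D

    restTerm-antisym : ∀ n u v D → Extensional D → restTerm n u v D ⊕ restTerm n v u D ≡ 𝟘
    restTerm-antisym zero u v D ext = trans (cong₂ _⊕_ (vanish u) (vanish v)) (R.+-identityˡ 𝟘)
      where
      vanish : ∀ w → 𝟙 ⊗ (w (suc zero) ⊗ 𝟘) ⊕ 𝟘 ≡ 𝟘
      vanish w = trans (R.+-identityʳ _) (trans (R.*-identityˡ _) (R.zeroʳ _))
    restTerm-antisym (suc n) u v D ext =
      trans (cong₂ _⊕_ (shrink u v) (shrink v u))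
            (pairSum-antisym n (λ i → u (suc i)) (λ i → v (suc i)) D′ ext′)
      where
      D′ : (Fin n → Fin (suc (suc n))) → 𝕂
      -- Row zero survives both deletions and stays the first row of the minor.
      D′ f = D (zero ∷ᶠ (λ r → suc (f r)))
      ext′ : Extensional D′
      ext′ e = ext λ { zero → refl ; (suc r) → cong suc (e r) }
      shrink : ∀ u v → restTerm (suc n) u v D ≡ pairSum n (λ i → u (suc i)) (λ i → v (suc i)) D′
      shrink u v = sumFin-cong (suc (suc n)) λ i → cong (λ z → sign i ⊗ (u (suc i) ⊗ z)) (sumFin-cong (suc n) λ k →
        cong (λ z → sign k ⊗ (v (suc (punchIn i k)) ⊗ z)) (ext (split i k)))
        where
        split : ∀ i k r → punchIn (suc i) (punchIn (suc k) r) ≡ (zero ∷ᶠ (λ r → suc (punchIn i (punchIn k r)))) r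
        split i k zero    = refl
        split i k (suc r) = refl

  module Odd (odd : ¬ (𝟙 ⊕ 𝟙 ≡ 𝟘)) where

    double-zero : ∀ {x} → x ⊕ x ≡ 𝟘 → x ≡ 𝟘
    double-zero {x} e = ⊗-zero-cancelʳ odd
      (trans (R.distribˡ x 𝟙 𝟙) (trans (cong₂ _⊕_ (R.*-identityʳ x) (R.*-identityʳ x)) e))

    -- The dot product is the determinant of M with a copy of column j put in front. Expanded along
    -- that copy and column zero of M it is a `pairSum`, so antisymmetry applies.
    cofactors-orthogonal : ∀ n (M : Fin (suc n) → Fin n → 𝕂) (j : Fin n) →
                           dot (λ i → M i j) (cofactors M) ≡ 𝟘
    cofactors-orthogonal (suc n) M j = trans (sumFin-cong (suc (suc n)) λ i →
        solve 3 (λ s a d → a :* (s :* d) := s :* (a :* d)) refl (sign i) (M i j) (Det (suc n) (λ r → M (punchIn i r))))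
      (vanish j)
      where
      minor : (Fin n → Fin (suc (suc n))) → 𝕂
      minor f = Det n (λ r c → M (f r) (suc c))
      minor-ext : Extensional minor
      minor-ext e = Det-cong n (λ r c → cong (λ z → M z (suc c)) (e r))
      column : Fin (suc n) → Fin (suc (suc n)) → 𝕂
      column j i = M i j
      vanish : ∀ j → pairSum n (column j) (column zero) minor ≡ 𝟘
      -- The two expansion columns coincide, so antisymmetry gives x + x = 0, and odd characteristic
      -- gives x = 0.
      vanish zero    = double-zero (pairSum-antisym n (column zero) (column zero) minor minor-ext)
      -- After exchanging the two expansion columns, each inner sum is the orthogonality relation
      -- for M without row i and column zero.
      vanish (suc j) = trans (sym (R.+-identityʳ _)) (trans (cong (pairSum n (column (suc j)) (column zero) minor ⊕_) (sym inner))
                         (pairSum-antisym n (column (suc j)) (column zero) minor minor-ext))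
        where
        inner : pairSum n (column zero) (column (suc j)) minor ≡ 𝟘
        inner = sumFin-zero (suc (suc n)) _ λ i →
          trans (cong (λ z → sign i ⊗ (M i zero ⊗ z))
            (trans (sumFin-cong (suc n) λ k →
                solve 3 (λ s a d → s :* (a :* d) := a :* (s :* d)) refl (sign k) (M (punchIn i k) (suc j)) (minor (λ r → punchIn i (punchIn k r))))
              (cofactors-orthogonal n (λ k c → M (punchIn i k) (suc c)) j)))
          (trans (cong (sign i ⊗_) (R.zeroʳ _)) (R.zeroʳ _))

    -- Orthogonality to column j is a linear equation for `c j` with leading coefficient `y zero`,
    -- and z is the inverse of that coefficient.
    firstRow-determined : ∀ {n} (c : Fin n → 𝕂) (P : Fin n → Fin n → 𝕂) {y : Fin (suc n) → 𝕂} {z : 𝕂} →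
                          (∀ i → cofactors (c ∷ᶠ P) i ≡ y i) → y zero ⊗ z ≡ 𝟙 →
                          ∀ j → c j ≡ ⊖ dot (λ i → P i j) (λ i → y (suc i)) ⊗ z
    firstRow-determined {n} c P {y} {z} cof≡y yz≡1 j = begin
      c j                    ≡⟨ sym (trans (cong (c j ⊗_) yz≡1) (R.*-identityʳ _)) ⟩
      c j ⊗ (y zero ⊗ z)     ≡⟨ sym (R.*-assoc _ _ _) ⟩
      c j ⊗ y zero ⊗ z       ≡⟨ cong (_⊗ z) (RP.+-inverseˡ-unique _ _ orthogonal) ⟩
      ⊖ dot (λ i → P i j) (λ i → y (suc i)) ⊗ z ∎
      where
      open ≡-Reasoning
      orthogonal : c j ⊗ y zero ⊕ dot (λ i → P i j) (λ i → y (suc i)) ≡ 𝟘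
      orthogonal = trans (dot-cong {a = λ i → (c ∷ᶠ P) i j} (λ _ → refl) (λ i → sym (cof≡y i)))
                         (cofactors-orthogonal n (c ∷ᶠ P) j)

-- Counting points on hyperplanes

module Count (F : FiniteField) where
  open Field F

  δ : 𝕂 → 𝕂 → ℕ
  δ x y = ⟦ ⌊ x ≟ y ⌋ ⟧

  δ-yes : ∀ {x y} → x ≡ y → δ x y ≡ 1
  δ-yes {x} {y} e with x ≟ y
  ... | yes _ = refl
  ... | no ne = ⊥-elim (ne e)

  δ-no : ∀ {x y} → ¬ (x ≡ y) → δ x y ≡ 0
  δ-no {x} {y} ne with x ≟ y
  ... | yes e = ⊥-elim (ne e)
  ... | no _  = refl

  δ-≤1 : ∀ x y → δ x y ≤ 1
  δ-≤1 x y with x ≟ y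
  ... | yes _ = ≤-refl
  ... | no _  = z≤n

  δ-mono : ∀ {x y u v} → (x ≡ y → u ≡ v) → δ x y ≤ δ u v
  δ-mono {x} {y} f with x ≟ y
  ... | yes e = ≤-reflexive (sym (δ-yes (f e)))
  ... | no _  = z≤n

  δ-cong : ∀ {x y u v} → (x ≡ y → u ≡ v) → (u ≡ v → x ≡ y) → δ x y ≡ δ u v
  δ-cong f g = ≤-antisym (δ-mono f) (δ-mono g)

  δ-*-≤ : ∀ {x y m n} → (x ≡ y → m ≤ n) → δ x y * m ≤ δ x y * n
  δ-*-≤ {x} {y} f with x ≟ y
  ... | yes e = +-monoˡ-≤ 0 (f e)
  ... | no _  = z≤n

  𝔽-single : ∀ s → ∑[ x ∈ 𝔽 ] δ x s ≡ 1
  𝔽-single s = ∑-tabulate-single (Inverse.from enum) (λ x → δ x s) (Inverse.to enum s)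
    (δ-yes (Inverse.strictlyInverseʳ enum s))
    (λ i i≢k → δ-no (λ e → i≢k (trans (sym (Inverse.strictlyInverseˡ enum i)) (cong (Inverse.to enum) e))))

  𝔽-length : length 𝔽 ≡ q
  𝔽-length = length-tabulate (Inverse.from enum)

  𝔽-pick : ∀ s (g : 𝕂 → ℕ) → ∑[ t ∈ 𝔽 ] (δ s t * g t) ≡ g s
  𝔽-pick s g = begin
    ∑[ t ∈ 𝔽 ] (δ s t * g t) ≡⟨ ∑-cong 𝔽 (λ t → at t) ⟩
    ∑[ t ∈ 𝔽 ] (δ t s * g s) ≡⟨ ∑-*ʳ 𝔽 (g s) (λ t → δ t s) ⟩
    ∑ 𝔽 (λ t → δ t s) * g s  ≡⟨ cong (_* g s) (𝔽-single s) ⟩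
    1 * g s                  ≡⟨ *-identityˡ (g s) ⟩
    g s                      ∎
    where
    open ≡-Reasoning
    at : ∀ t → δ s t * g t ≡ δ t s * g s
    at t with s ≟ t | t ≟ s
    ... | yes refl | yes _ = refl
    ... | yes refl | no ne = ⊥-elim (ne refl)
    ... | no ne | yes refl = ⊥-elim (ne refl)
    ... | no _  | no _  = refl

  -- Multiplication by t permutes the field; instead of permuting the list, the proof counts, for
  -- each u, the single x with x t = u.
  𝔽-rescale : ∀ {t} → ¬ (t ≡ 𝟘) → (g : 𝕂 → ℕ) → ∑[ x ∈ 𝔽 ] g (x ⊗ t) ≡ ∑ 𝔽 g
  𝔽-rescale {t} t≢0 g with inverse t t≢0
  ... | z , tz≡1 = begin
    ∑[ x ∈ 𝔽 ] g (x ⊗ t)                          ≡⟨ ∑-cong 𝔽 (λ x → sym (𝔽-pick (x ⊗ t) g)) ⟩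
    ∑[ x ∈ 𝔽 ] ∑[ u ∈ 𝔽 ] (δ (x ⊗ t) u * g u)     ≡⟨ ∑-swap 𝔽 𝔽 _ ⟩
    ∑[ u ∈ 𝔽 ] ∑[ x ∈ 𝔽 ] (δ (x ⊗ t) u * g u)     ≡⟨ ∑-cong 𝔽 (λ u → trans (∑-*ʳ 𝔽 (g u) (λ x → δ (x ⊗ t) u)) (trans (cong (_* g u) (once u)) (*-identityˡ (g u)))) ⟩
    ∑ 𝔽 g                                         ∎
    where
    open ≡-Reasoning
    once : ∀ u → ∑[ x ∈ 𝔽 ] δ (x ⊗ t) u ≡ 1
    once u = trans (∑-cong 𝔽 (λ x → δ-cong {x ⊗ t} {u} {x} {u ⊗ z}
        (λ e → ⊗-cancelʳ t≢0 (trans e (sym uzt)))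
        (λ e → trans (cong (_⊗ t) e) uzt)))
      (𝔽-single (u ⊗ z))
      where
      uzt : u ⊗ z ⊗ t ≡ u
      uzt = trans (R.*-assoc u z t) (trans (cong (u ⊗_) (trans (R.*-comm z t) tz≡1)) (R.*-identityʳ u))

  -- Multiplicities are expressed as sums of `δ`, the form in which the counting lemmas consume
  -- them.
  Nodup : List 𝕂 → Set
  Nodup S = ∀ s → ∑[ x ∈ S ] δ x s ≤ 1

  𝔽-nodup : Nodup 𝔽
  𝔽-nodup s = ≤-reflexive (𝔽-single s)

  filter-nodup : ∀ A → Nodup (filterᵇ A 𝔽)
  filter-nodup A s = ≤-trans (∑-filter-≤ A 𝔽 _) (𝔽-nodup s)

  ∑-allFuns : ∀ (xs : List X) n (f : (Fin (suc n) → X) → ℕ) →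
              ∑ (allFuns xs (suc n)) f ≡ ∑[ x ∈ xs ] ∑[ a ∈ allFuns xs n ] f (x ∷ᶠ a)
  ∑-allFuns xs n f = trans (∑-concatMap (λ x → map (x ∷ᶠ_) (allFuns xs n)) xs f)
                           (∑-cong xs (λ x → ∑-map (x ∷ᶠ_) (allFuns xs n) f))

  length-allFuns : ∀ (xs : List X) n → length (allFuns xs n) ≡ length xs ^ n
  length-allFuns xs zero    = refl
  length-allFuns xs (suc n) = begin
    length (allFuns xs (suc n))            ≡⟨ sym (∑-one (allFuns xs (suc n))) ⟩
    ∑[ _ ∈ allFuns xs (suc n) ] 1          ≡⟨ ∑-allFuns xs n _ ⟩
    ∑[ x ∈ xs ] ∑[ a ∈ allFuns xs n ] 1    ≡⟨ ∑-const xs _ ⟩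
    length xs * ∑[ a ∈ allFuns xs n ] 1    ≡⟨ cong (length xs *_) (trans (∑-one (allFuns xs n)) (length-allFuns xs n)) ⟩
    length xs ^ suc n                      ∎
    where open ≡-Reasoning

  ∑-allFuns-filter-≤ : ∀ (p : X → Bool) (xs : List X) n (f : (Fin n → X) → ℕ) →
                       ∑ (allFuns (filterᵇ p xs) n) f ≤ ∑ (allFuns xs n) f
  ∑-allFuns-filter-≤ p xs zero    f = ≤-refl
  ∑-allFuns-filter-≤ p xs (suc n) f = begin
    ∑ (allFuns (filterᵇ p xs) (suc n)) f                            ≡⟨ ∑-allFuns (filterᵇ p xs) n f ⟩
    ∑[ x ∈ filterᵇ p xs ] ∑[ a ∈ allFuns (filterᵇ p xs) n ] f (x ∷ᶠ a) ≤⟨ ∑-mono (filterᵇ p xs) (λ x → ∑-allFuns-filter-≤ p xs n _) ⟩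
    ∑[ x ∈ filterᵇ p xs ] ∑[ a ∈ allFuns xs n ] f (x ∷ᶠ a)          ≤⟨ ∑-filter-≤ p xs _ ⟩
    ∑[ x ∈ xs ] ∑[ a ∈ allFuns xs n ] f (x ∷ᶠ a)                    ≡⟨ sym (∑-allFuns xs n f) ⟩
    ∑ (allFuns xs (suc n)) f                                        ∎
    where open ≤-Reasoning

  affine-root : ∀ {y} → ¬ (y ≡ 𝟘) → ∀ r t → Σ 𝕂 (λ v → ∀ x → (x ⊗ y ⊕ r ≡ t → x ≡ v) × (x ≡ v → x ⊗ y ⊕ r ≡ t))
  affine-root {y} y≢0 r t with inverse y y≢0
  ... | z , yz≡1 = v , λ x → (λ e → ⊗-cancelʳ y≢0 (⊕-cancelʳ r (trans e (sym root)))) , (λ { refl → root })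
    where
    v : 𝕂
    v = (t ⊕ ⊖ r) ⊗ z
    open ≡-Reasoning
    root : v ⊗ y ⊕ r ≡ t
    root = begin
      (t ⊕ ⊖ r) ⊗ z ⊗ y ⊕ r ≡⟨ cong (_⊕ r) (trans (R.*-assoc _ z y) (trans (cong ((t ⊕ ⊖ r) ⊗_) (trans (R.*-comm z y) yz≡1)) (R.*-identityʳ _))) ⟩
      t ⊕ ⊖ r ⊕ r           ≡⟨ R.+-assoc t (⊖ r) r ⟩
      t ⊕ (⊖ r ⊕ r)         ≡⟨ cong (t ⊕_) (R.-‿inverseˡ r) ⟩
      t ⊕ 𝟘                 ≡⟨ R.+-identityʳ t ⟩
      t                     ∎

  affine-≤1 : ∀ S {y} → Nodup S → ¬ (y ≡ 𝟘) → ∀ r t → ∑[ x ∈ S ] δ (x ⊗ y ⊕ r) t ≤ 1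
  affine-≤1 S nd y≢0 r t with affine-root y≢0 r t
  ... | v , root = ≤-trans (∑-mono S (λ x → δ-mono (proj₁ (root x)))) (nd v)

  affine-≡1 : ∀ {y} → ¬ (y ≡ 𝟘) → ∀ r t → ∑[ x ∈ 𝔽 ] δ (x ⊗ y ⊕ r) t ≡ 1
  affine-≡1 y≢0 r t with affine-root y≢0 r t
  ... | v , root = trans (∑-cong 𝔽 (λ x → δ-cong (proj₁ (root x)) (proj₂ (root x)))) (𝔽-single v)

  hyperplane-first : ∀ S → Nodup S → ∀ {n} (w : Fin (suc n) → 𝕂) s → ¬ (w zero ≡ 𝟘) →
                     ∑[ a ∈ allFuns S (suc n) ] δ (dot a w) s ≤ length S ^ n
  hyperplane-first S nd {n} w s w₀≢0 = begin
    ∑[ a ∈ allFuns S (suc n) ] δ (dot a w) s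
      ≡⟨ trans (∑-allFuns S n _) (∑-swap S (allFuns S n) _) ⟩
    ∑[ a ∈ allFuns S n ] ∑[ x ∈ S ] δ (x ⊗ w zero ⊕ dot a (λ i → w (suc i))) s
      ≤⟨ ∑-mono (allFuns S n) (λ a → affine-≤1 S nd w₀≢0 _ s) ⟩
    ∑[ a ∈ allFuns S n ] 1
      ≡⟨ trans (∑-one (allFuns S n)) (length-allFuns S n) ⟩
    length S ^ n ∎
    where open ≤-Reasoning

  -- A coordinate with nonzero coefficient is determined by the others. The premise excludes exactly
  -- the equation 0 = 0, and the factor |S| on the left replaces the exponent n - 1 on the right.
  hyperplane-≤ : ∀ S → Nodup S → ∀ {n} (w : Fin n → 𝕂) s → ¬ (s ≡ 𝟘 × (∀ i → w i ≡ 𝟘)) →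
                 (∑[ a ∈ allFuns S n ] δ (dot a w) s) * length S ≤ length S ^ n
  hyperplane-≤ S nd {zero} w s ¬trivial =
    ≤-trans (≤-reflexive (cong (λ m → (m + 0) * length S) (δ-no {𝟘} {s} (λ e → ¬trivial (sym e , λ ()))))) z≤n
  hyperplane-≤ S nd {suc n} w s ¬trivial with w zero ≟ 𝟘
  ... | no w₀≢0 = ≤-trans (*-monoˡ-≤ (length S) (hyperplane-first S nd w s w₀≢0)) (≤-reflexive (*-comm _ (length S)))
  ... | yes w₀≡0 = begin
    (∑[ a ∈ allFuns S (suc n) ] δ (dot a w) s) * length S
      ≡⟨ cong (_* length S) (∑-allFuns S n _) ⟩
    (∑[ x ∈ S ] ∑[ a ∈ allFuns S n ] δ (x ⊗ w zero ⊕ dot a w′) s) * length S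
      ≡⟨ cong (_* length S) (∑-cong S (λ x → ∑-cong (allFuns S n) (λ a → cong (λ z → δ z s) (drop x (dot a w′))))) ⟩
    (∑[ x ∈ S ] ∑[ a ∈ allFuns S n ] δ (dot a w′) s) * length S
      ≡⟨ trans (cong (_* length S) (∑-const S _)) (*-assoc (length S) _ _) ⟩
    length S * ((∑[ a ∈ allFuns S n ] δ (dot a w′) s) * length S)
      ≤⟨ *-monoʳ-≤ (length S) (hyperplane-≤ S nd w′ s (λ (e , z) → ¬trivial (e , λ { zero → w₀≡0 ; (suc i) → z i }))) ⟩
    length S ^ suc n ∎
    where
    open ≤-Reasoning
    w′ : Fin n → 𝕂
    w′ i = w (suc i)
    drop : ∀ x r → x ⊗ w zero ⊕ r ≡ r
    drop x r = trans (cong (_⊕ r) (trans (cong (x ⊗_) w₀≡0) (R.zeroʳ x))) (R.+-identityˡ r)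

  hyperplane-𝔽 : ∀ {n} (y : Fin (suc n) → 𝕂) t → ¬ (y zero ≡ 𝟘) →
                 ∑[ a ∈ allFuns 𝔽 (suc n) ] δ (dot a y) t ≡ q ^ n
  hyperplane-𝔽 {n} y t y₀≢0 = begin
    ∑[ a ∈ allFuns 𝔽 (suc n) ] δ (dot a y) t
      ≡⟨ trans (∑-allFuns 𝔽 n _) (∑-swap 𝔽 (allFuns 𝔽 n) _) ⟩
    ∑[ a ∈ allFuns 𝔽 n ] ∑[ x ∈ 𝔽 ] δ (x ⊗ y zero ⊕ dot a (λ i → y (suc i))) t
      ≡⟨ ∑-cong (allFuns 𝔽 n) (λ a → affine-≡1 y₀≢0 _ t) ⟩
    ∑[ a ∈ allFuns 𝔽 n ] 1
      ≡⟨ trans (∑-one (allFuns 𝔽 n)) (trans (length-allFuns 𝔽 n) (cong (_^ n) 𝔽-length)) ⟩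
    q ^ n ∎
    where open ≡-Reasoning

  -- A number rather than a proposition, so that collisions can be summed; it compares coordinates
  -- because vectors are functions.
  eqv : ∀ {n} → (Fin n → 𝕂) → (Fin n → 𝕂) → ℕ
  eqv {zero}  u v = 1
  eqv {suc n} u v = δ (u zero) (v zero) * eqv (λ i → u (suc i)) (λ i → v (suc i))

  eqv-yes : ∀ {n} {u v : Fin n → 𝕂} → (∀ i → u i ≡ v i) → eqv u v ≡ 1
  eqv-yes {zero}  e = refl
  eqv-yes {suc n} e = cong₂ _*_ (δ-yes (e zero)) (eqv-yes (λ i → e (suc i)))

  eqv-cases : ∀ {n} (u v : Fin n → 𝕂) → (∀ i → u i ≡ v i) ⊎ eqv u v ≡ 0
  eqv-cases {zero}  u v = inj₁ λ ()
  eqv-cases {suc n} u v with u zero ≟ v zero | eqv-cases (λ i → u (suc i)) (λ i → v (suc i))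
  ... | yes e | inj₁ es = inj₁ λ { zero → e ; (suc i) → es i }
  ... | yes e | inj₂ z  = inj₂ (trans (+-identityʳ _) z)
  ... | no _  | _       = inj₂ refl

  eqv-≤ : ∀ {n} {u v : Fin n → 𝕂} {m} → ((∀ i → u i ≡ v i) → 1 ≤ m) → eqv u v ≤ m
  eqv-≤ {u = u} {v} f with eqv-cases u v
  ... | inj₁ e = ≤-trans (≤-reflexive (eqv-yes e)) (f e)
  ... | inj₂ z = ≤-trans (≤-reflexive z) z≤n

  ∑-eqv-≤1 : ∀ S → Nodup S → ∀ {n} (v : Fin n → 𝕂) → ∑[ a ∈ allFuns S n ] eqv a v ≤ 1
  ∑-eqv-≤1 S nd {zero}  v = ≤-refl
  ∑-eqv-≤1 S nd {suc n} v = begin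
    ∑[ a ∈ allFuns S (suc n) ] eqv a v
      ≡⟨ ∑-allFuns S n _ ⟩
    ∑[ x ∈ S ] ∑[ a ∈ allFuns S n ] (δ x (v zero) * eqv a (λ i → v (suc i)))
      ≡⟨ sym (∑-product S (allFuns S n) _ _) ⟩
    (∑[ x ∈ S ] δ x (v zero)) * (∑[ a ∈ allFuns S n ] eqv a (λ i → v (suc i)))
      ≤⟨ *-mono-≤ (nd (v zero)) (∑-eqv-≤1 S nd (λ i → v (suc i))) ⟩
    1 ∎
    where open ≤-Reasoning

-- Variance of incidence counts

module Variance (F : FiniteField) where
  open Field F
  open Count F

  sub-zero : ∀ {x y} → x ⊕ ⊖ y ≡ 𝟘 → x ≡ y
  sub-zero {x} {y} e = ⊕-cancelʳ (⊖ y) (trans e (sym (R.-‿inverseʳ y)))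

  sub-cancelˡ : ∀ c u v → c ⊕ u ⊕ ⊖ (c ⊕ v) ≡ u ⊕ ⊖ v
  sub-cancelˡ c u v = begin
    c ⊕ u ⊕ ⊖ (c ⊕ v)     ≡⟨ cong₂ _⊕_ (R.+-comm c u) (sym (RP.-‿+-comm c v)) ⟩
    u ⊕ c ⊕ (⊖ c ⊕ ⊖ v)   ≡⟨ trans (R.+-assoc u c _) (cong (u ⊕_) (sym (R.+-assoc c (⊖ c) (⊖ v)))) ⟩
    u ⊕ (c ⊕ ⊖ c ⊕ ⊖ v)   ≡⟨ cong (u ⊕_) (trans (cong (_⊕ ⊖ v) (R.-‿inverseʳ c)) (R.+-identityˡ (⊖ v))) ⟩
    u ⊕ ⊖ v               ∎
    where open ≡-Reasoning

  -- Coefficients left after eliminating the first unknown from a·y and a·y′.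
  eliminant : ∀ {n} → (Fin (suc n) → 𝕂) → (Fin (suc n) → 𝕂) → Fin n → 𝕂
  eliminant y y′ i = y′ zero ⊗ y (suc i) ⊕ ⊖ (y zero ⊗ y′ (suc i))

  dot-eliminant : ∀ {n} (y y′ : Fin (suc n) → 𝕂) (a : Fin n → 𝕂) → dot a (eliminant y y′) ≡
                  y′ zero ⊗ dot a (λ i → y (suc i)) ⊕ ⊖ (y zero ⊗ dot a (λ i → y′ (suc i)))
  dot-eliminant {n} y y′ a = begin
    dot a (eliminant y y′)
      ≡⟨ sumFin-cong n (λ i → trans (R.distribˡ (a i) _ _) (cong₂ _⊕_ (exchange (a i) (y′ zero) (y (suc i)))
           (trans (sym (RP.-‿distribʳ-* (a i) _)) (cong ⊖_ (exchange (a i) (y zero) (y′ (suc i))))))) ⟩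
    sumFin n (λ i → y′ zero ⊗ f i ⊕ ⊖ (y zero ⊗ g i))
      ≡⟨ sumFin-⊕ n (λ i → y′ zero ⊗ f i) (λ i → ⊖ (y zero ⊗ g i)) ⟩
    sumFin n (λ i → y′ zero ⊗ f i) ⊕ sumFin n (λ i → ⊖ (y zero ⊗ g i))
      ≡⟨ cong₂ _⊕_ (sumFin-⊗ n (y′ zero) f)
           (trans (sumFin-⊖ n (λ i → y zero ⊗ g i)) (cong ⊖_ (sumFin-⊗ n (y zero) g))) ⟩
    y′ zero ⊗ sumFin n f ⊕ ⊖ (y zero ⊗ sumFin n g) ∎
    where
    open ≡-Reasoning
    f g : Fin n → 𝕂
    f i = a i ⊗ y (suc i)
    g i = a i ⊗ y′ (suc i)
    exchange : ∀ u v z → u ⊗ (v ⊗ z) ≡ v ⊗ (u ⊗ z)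
    exchange u v z = trans (sym (R.*-assoc u v z)) (trans (cong (_⊗ z) (R.*-comm u v)) (R.*-assoc v u z))

  -- `y′ zero` times the first equation minus `y zero` times the second: the terms in x cancel.
  eliminate : ∀ {n} (y y′ : Fin (suc n) → 𝕂) {t} (a : Fin n → 𝕂) x →
              x ⊗ y zero ⊕ dot a (λ i → y (suc i)) ≡ t → x ⊗ y′ zero ⊕ dot a (λ i → y′ (suc i)) ≡ t →
              dot a (eliminant y y′) ≡ y′ zero ⊗ t ⊕ ⊖ (y zero ⊗ t)
  eliminate y y′ {t} a x e e′ = begin
    dot a (eliminant y y′)
      ≡⟨ dot-eliminant y y′ a ⟩
    y′ zero ⊗ r ⊕ ⊖ (y zero ⊗ r′)
      ≡⟨ sym (sub-cancelˡ (y′ zero ⊗ (x ⊗ y zero)) _ _) ⟩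
    y′ zero ⊗ (x ⊗ y zero) ⊕ y′ zero ⊗ r ⊕ ⊖ (y′ zero ⊗ (x ⊗ y zero) ⊕ y zero ⊗ r′)
      ≡⟨ cong₂ (λ u v → u ⊕ ⊖ v) (trans (sym (R.distribˡ _ _ _)) (cong (y′ zero ⊗_) e))
           (trans (cong (_⊕ y zero ⊗ r′) rotate) (trans (sym (R.distribˡ _ _ _)) (cong (y zero ⊗_) e′))) ⟩
    y′ zero ⊗ t ⊕ ⊖ (y zero ⊗ t) ∎
    where
    open ≡-Reasoning
    r r′ : 𝕂
    r = dot a (λ i → y (suc i))
    r′ = dot a (λ i → y′ (suc i))
    rotate : y′ zero ⊗ (x ⊗ y zero) ≡ y zero ⊗ (x ⊗ y′ zero)
    rotate = trans (sym (R.*-assoc _ _ _)) (trans (R.*-comm _ _) (cong (y zero ⊗_) (R.*-comm _ _)))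

  -- For y ≠ y′ the first equation fixes the first coordinate of a and leaves the eliminated
  -- equation in n unknowns, with at most q^(n-1) solutions. For y = y′ there is only one
  -- hyperplane.
  pair-≤ : ∀ {n} (y y′ : Fin (suc n) → 𝕂) {t} → ¬ (t ≡ 𝟘) → ¬ (y zero ≡ 𝟘) → ¬ (y′ zero ≡ 𝟘) →
           (∑[ a ∈ allFuns 𝔽 (suc n) ] (δ (dot a y) t * δ (dot a y′) t)) * q ≤ q ^ n + eqv y y′ * q ^ suc n
  pair-≤ {n} y y′ {t} t≢0 y₀≢0 y′₀≢0 with eqv-cases y y′
  ... | inj₁ e = begin
    (∑[ a ∈ allFuns 𝔽 (suc n) ] (δ (dot a y) t * δ (dot a y′) t)) * q
      ≤⟨ *-monoˡ-≤ q (∑-mono (allFuns 𝔽 (suc n)) (λ a → ≤-trans (*-monoʳ-≤ (δ (dot a y) t) (δ-≤1 (dot a y′) t)) (≤-reflexive (*-identityʳ _)))) ⟩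
    (∑[ a ∈ allFuns 𝔽 (suc n) ] δ (dot a y) t) * q
      ≡⟨ trans (cong (_* q) (hyperplane-𝔽 y t y₀≢0)) (*-comm (q ^ n) q) ⟩
    q ^ suc n
      ≤⟨ m≤n+m (q ^ suc n) (q ^ n) ⟩
    q ^ n + q ^ suc n
      ≡⟨ cong (q ^ n +_) (sym (trans (cong (_* q ^ suc n) (eqv-yes e)) (*-identityˡ (q ^ suc n)))) ⟩
    q ^ n + eqv y y′ * q ^ suc n ∎
    where open ≤-Reasoning
  ... | inj₂ neq = begin
    (∑[ a ∈ allFuns 𝔽 (suc n) ] (δ (dot a y) t * δ (dot a y′) t)) * q
      ≡⟨ cong (_* q) (trans (∑-allFuns 𝔽 n _) (∑-swap 𝔽 (allFuns 𝔽 n) _)) ⟩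
    (∑[ a ∈ allFuns 𝔽 n ] ∑[ x ∈ 𝔽 ] (δ (x ⊗ y zero ⊕ dot a ỹ) t * δ (x ⊗ y′ zero ⊕ dot a ỹ′) t)) * q
      ≤⟨ *-monoˡ-≤ q (∑-mono (allFuns 𝔽 n) (λ a → ∑-mono 𝔽 (λ x →
           δ-*-≤ {x ⊗ y zero ⊕ dot a ỹ} {t} (λ e → δ-mono (λ e′ → eliminate y y′ a x e e′))))) ⟩
    (∑[ a ∈ allFuns 𝔽 n ] ∑[ x ∈ 𝔽 ] (δ (x ⊗ y zero ⊕ dot a ỹ) t * δ (dot a w) s)) * q
      ≡⟨ cong (_* q) (∑-cong (allFuns 𝔽 n) (λ a →
           trans (∑-*ʳ 𝔽 (δ (dot a w) s) (λ x → δ (x ⊗ y zero ⊕ dot a ỹ) t))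
             (trans (cong (_* δ (dot a w) s) (affine-≡1 y₀≢0 (dot a ỹ) t)) (*-identityˡ _)))) ⟩
    (∑[ a ∈ allFuns 𝔽 n ] δ (dot a w) s) * q
      ≤⟨ subst (λ k → (∑[ a ∈ allFuns 𝔽 n ] δ (dot a w) s) * k ≤ k ^ n) 𝔽-length (hyperplane-≤ 𝔽 𝔽-nodup w s nontrivial) ⟩
    q ^ n
      ≤⟨ m≤m+n (q ^ n) _ ⟩
    q ^ n + eqv y y′ * q ^ suc n ∎
    where
    open ≤-Reasoning
    ỹ ỹ′ w : Fin n → 𝕂
    ỹ i = y (suc i)
    ỹ′ i = y′ (suc i)
    w = eliminant y y′
    s : 𝕂
    s = y′ zero ⊗ t ⊕ ⊖ (y zero ⊗ t)
    -- The right side vanishes only for equal heads, because t ≠ 0; after that, vanishing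
    -- coefficients force equal tails.
    nontrivial : ¬ (s ≡ 𝟘 × (∀ i → w i ≡ 𝟘))
    nontrivial (s≡0 , w≡0) with trans (sym neq) (eqv-yes {u = y} {y′} λ { zero → sym heads ; (suc i) → tails i })
      where
      heads : y′ zero ≡ y zero
      heads = ⊗-cancelʳ t≢0 (sub-zero s≡0)
      tails : ∀ i → ỹ i ≡ ỹ′ i
      tails i = ⊗-cancelʳ y₀≢0 (trans (R.*-comm _ _) (trans (cong (_⊗ ỹ i) (sym heads))
                  (trans (sub-zero (w≡0 i)) (R.*-comm _ _))))
    ... | ()

  𝔽-rescale-vec : ∀ {t} → ¬ (t ≡ 𝟘) → ∀ n (g : (Fin n → 𝕂) → ℕ) → (∀ {a b} → (∀ i → a i ≡ b i) → g a ≡ g b) →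
                  ∑[ a ∈ allFuns 𝔽 n ] g (λ i → a i ⊗ t) ≡ ∑ (allFuns 𝔽 n) g
  𝔽-rescale-vec {t} t≢0 zero    g ext = cong (_+ 0) (ext λ ())
  𝔽-rescale-vec {t} t≢0 (suc n) g ext = begin
    ∑[ a ∈ allFuns 𝔽 (suc n) ] g (λ i → a i ⊗ t)
      ≡⟨ ∑-allFuns 𝔽 n _ ⟩
    ∑[ x ∈ 𝔽 ] ∑[ a ∈ allFuns 𝔽 n ] g (λ i → (x ∷ᶠ a) i ⊗ t)
      ≡⟨ ∑-cong 𝔽 (λ x → ∑-cong (allFuns 𝔽 n) (λ a → ext λ { zero → refl ; (suc i) → refl })) ⟩
    ∑[ x ∈ 𝔽 ] ∑[ a ∈ allFuns 𝔽 n ] g ((x ⊗ t) ∷ᶠ (λ i → a i ⊗ t))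
      ≡⟨ ∑-cong 𝔽 (λ x → 𝔽-rescale-vec t≢0 n (λ a → g ((x ⊗ t) ∷ᶠ a)) (λ e → ext λ { zero → refl ; (suc i) → e i })) ⟩
    ∑[ x ∈ 𝔽 ] ∑[ a ∈ allFuns 𝔽 n ] g ((x ⊗ t) ∷ᶠ a)
      ≡⟨ 𝔽-rescale t≢0 (λ x → ∑[ a ∈ allFuns 𝔽 n ] g (x ∷ᶠ a)) ⟩
    ∑[ x ∈ 𝔽 ] ∑[ a ∈ allFuns 𝔽 n ] g (x ∷ᶠ a)
      ≡⟨ sym (∑-allFuns 𝔽 n g) ⟩
    ∑ (allFuns 𝔽 (suc n)) g ∎
    where open ≡-Reasoning

  ∏ : (X → ℕ) → ∀ {n} → (Fin n → X) → ℕ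
  ∏ ω {zero}  a = 1
  ∏ ω {suc n} a = ω (a zero) * ∏ ω (λ i → a (suc i))

  ∏-cong : ∀ {ω ω′ : X → ℕ} → (∀ x → ω x ≡ ω′ x) → ∀ {n} (a : Fin n → X) → ∏ ω a ≡ ∏ ω′ a
  ∏-cong e {zero}  a = refl
  ∏-cong e {suc n} a = cong₂ _*_ (e (a zero)) (∏-cong e (λ i → a (suc i)))

  χ : (X → Bool) → ∀ {n} → (Fin n → X) → ℕ
  χ p = ∏ (λ x → ⟦ p x ⟧)

  χ-≤1 : ∀ (p : X → Bool) {n} (a : Fin n → X) → χ p a ≤ 1
  χ-≤1 p {zero}  a = ≤-refl
  χ-≤1 p {suc n} a with p (a zero)
  ... | true  = ≤-trans (≤-reflexive (+-identityʳ _)) (χ-≤1 p (λ i → a (suc i)))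
  ... | false = z≤n

  χ-≤ : ∀ (p : X → Bool) {n} (a : Fin n → X) i → χ p a ≤ ⟦ p (a i) ⟧
  χ-≤ p {suc n} a zero = ≤-trans (*-monoʳ-≤ ⟦ p (a zero) ⟧ (χ-≤1 p (λ i → a (suc i)))) (≤-reflexive (*-identityʳ _))
  χ-≤ p {suc n} a (suc i) with p (a zero)
  ... | true  = ≤-trans (≤-reflexive (+-identityʳ _)) (χ-≤ p (λ i → a (suc i)) i)
  ... | false = z≤n

  χ-cong : ∀ (p : X → Bool) {n} {a b : Fin n → X} → (∀ i → a i ≡ b i) → χ p a ≡ χ p b
  χ-cong p {zero}  e = refl
  χ-cong p {suc n} e = cong₂ _*_ (cong (λ x → ⟦ p x ⟧) (e zero)) (χ-cong p (λ i → e (suc i)))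

  -- A general weight permits two applications: to the entries of a row, then to the rows of a
  -- matrix.
  ∑-allFuns-weighted : ∀ {ω : X → ℕ} {xs ys : List X} → (∀ f → ∑ xs f ≡ ∑[ x ∈ ys ] (ω x * f x)) →
                       ∀ n (f : (Fin n → X) → ℕ) → ∑ (allFuns xs n) f ≡ ∑[ a ∈ allFuns ys n ] (∏ ω a * f a)
  ∑-allFuns-weighted             e zero    f = cong (_+ 0) (sym (*-identityˡ _))
  ∑-allFuns-weighted {ω = ω} {xs} {ys} e (suc n) f = begin
    ∑ (allFuns xs (suc n)) f
      ≡⟨ ∑-allFuns xs n f ⟩
    ∑[ x ∈ xs ] ∑[ a ∈ allFuns xs n ] f (x ∷ᶠ a)
      ≡⟨ ∑-cong xs (λ x → ∑-allFuns-weighted e n _) ⟩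
    ∑[ x ∈ xs ] ∑[ a ∈ allFuns ys n ] (∏ ω a * f (x ∷ᶠ a))
      ≡⟨ e _ ⟩
    ∑[ x ∈ ys ] (ω x * ∑[ a ∈ allFuns ys n ] (∏ ω a * f (x ∷ᶠ a)))
      ≡⟨ ∑-cong ys (λ x → trans (sym (∑-*ˡ (allFuns ys n) (ω x) _)) (∑-cong (allFuns ys n) (λ a → sym (*-assoc (ω x) _ _)))) ⟩
    ∑[ x ∈ ys ] ∑[ a ∈ allFuns ys n ] (∏ ω (x ∷ᶠ a) * f (x ∷ᶠ a))
      ≡⟨ sym (∑-allFuns ys n _) ⟩
    ∑[ a ∈ allFuns ys (suc n) ] (∏ ω a * f a) ∎
    where open ≡-Reasoning

  ∑-allFuns-filter : ∀ (p : X → Bool) (xs : List X) n (f : (Fin n → X) → ℕ) →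
                     ∑ (allFuns (filterᵇ p xs) n) f ≡ ∑[ a ∈ allFuns xs n ] (χ p a * f a)
  ∑-allFuns-filter p xs = ∑-allFuns-weighted (∑-filter p xs)

  units : List 𝕂
  units = filterᵇ (λ t → not ⌊ t ≟ 𝟘 ⌋) 𝔽

  ∈-units : ∀ {t} → t ∈ units → ¬ (t ≡ 𝟘)
  ∈-units {t} i e with t ≟ 𝟘 | ∈-filterᵇ (λ t → not ⌊ t ≟ 𝟘 ⌋) 𝔽 i
  ... | yes _ | ()
  ... | no ne | _ = ne e

  length-units : length units ≤ q
  length-units = begin
    length units      ≡⟨ sym (∑-one units) ⟩
    ∑[ _ ∈ units ] 1  ≤⟨ ∑-filter-≤ _ 𝔽 _ ⟩
    ∑[ _ ∈ 𝔽 ] 1      ≡⟨ trans (∑-one 𝔽) 𝔽-length ⟩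
    q                 ∎
    where open ≤-Reasoning

  find-nonzero : ∀ {n} (a : Fin n → 𝕂) → (∀ i → a i ≡ 𝟘) ⊎ Σ (Fin n) (λ i → ¬ (a i ≡ 𝟘))
  find-nonzero {zero}  a = inj₁ λ ()
  find-nonzero {suc n} a with a zero ≟ 𝟘 | find-nonzero (λ i → a (suc i))
  ... | no ne | _            = inj₂ (zero , ne)
  ... | yes e | inj₁ es      = inj₁ λ { zero → e ; (suc i) → es i }
  ... | yes e | inj₂ (i , ne) = inj₂ (suc i , ne)

  -- One nonzero coordinate suffices: t ↦ a_i t is injective, so it lands in A for at most |A|
  -- values of t. The zero vector is charged the trivial q.
  χ-dilates : ∀ (A : 𝕂 → Bool) {n} (a : Fin n → 𝕂) →
              ∑[ t ∈ units ] χ A (λ i → a i ⊗ t) ≤ length (filterᵇ A 𝔽) + q * eqv a (λ _ → 𝟘)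
  χ-dilates A a with find-nonzero a
  ... | inj₁ e = begin
    ∑[ t ∈ units ] χ A (λ i → a i ⊗ t)            ≤⟨ ∑-mono units (λ t → χ-≤1 A (λ i → a i ⊗ t)) ⟩
    ∑[ _ ∈ units ] 1                              ≤⟨ ≤-trans (≤-reflexive (∑-one units)) length-units ⟩
    q                                             ≡⟨ sym (trans (cong (q *_) (eqv-yes e)) (*-identityʳ q)) ⟩
    q * eqv a (λ _ → 𝟘)                           ≤⟨ m≤n+m _ _ ⟩
    length (filterᵇ A 𝔽) + q * eqv a (λ _ → 𝟘)    ∎
    where open ≤-Reasoning
  ... | inj₂ (i , ne) = begin
    ∑[ t ∈ units ] χ A (λ i → a i ⊗ t)            ≤⟨ ∑-mono units (λ t → χ-≤ A (λ i → a i ⊗ t) i) ⟩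
    ∑[ t ∈ units ] ⟦ A (a i ⊗ t) ⟧                ≤⟨ ∑-filter-≤ _ 𝔽 _ ⟩
    ∑[ t ∈ 𝔽 ] ⟦ A (a i ⊗ t) ⟧                    ≡⟨ ∑-cong 𝔽 (λ t → cong (λ z → ⟦ A z ⟧) (R.*-comm (a i) t)) ⟩
    ∑[ t ∈ 𝔽 ] ⟦ A (t ⊗ a i) ⟧                    ≡⟨ 𝔽-rescale ne (λ t → ⟦ A t ⟧) ⟩
    ∑[ t ∈ 𝔽 ] ⟦ A t ⟧                            ≡⟨ sym (length-filter A 𝔽) ⟩
    length (filterᵇ A 𝔽)                          ≤⟨ m≤m+n _ _ ⟩
    length (filterᵇ A 𝔽) + q * eqv a (λ _ → 𝟘)    ∎
    where open ≤-Reasoning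

  module Incidence {X : Set} {n : ℕ} (I : List X) (y : X → Fin (suc n) → 𝕂)
                   (y₀≢0 : ∀ {x} → x ∈ I → ¬ (y x zero ≡ 𝟘)) where

    L collisions : ℕ
    L = length I
    collisions = ∑[ x ∈ I ] ∑[ x′ ∈ I ] eqv (y x) (y x′)

    -- The mean of `incidences` over all a is L / q, so `discrepancy` is q times the deviation from
    -- the mean, kept integral.
    incidences discrepancy : (Fin (suc n) → 𝕂) → 𝕂 → ℕ
    incidences a t = ∑[ x ∈ I ] δ (dot a (y x)) t
    discrepancy a t = ∣ q * incidences a t - L ∣

    discrepancy² : (Fin (suc n) → 𝕂) → 𝕂 → ℕ
    discrepancy² a t = discrepancy a t * discrepancy a t

    first-moment : ∀ t → ∑[ a ∈ allFuns 𝔽 (suc n) ] incidences a t ≡ L * q ^ n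
    first-moment t = begin
      ∑[ a ∈ allFuns 𝔽 (suc n) ] ∑[ x ∈ I ] δ (dot a (y x)) t ≡⟨ ∑-swap (allFuns 𝔽 (suc n)) I _ ⟩
      ∑[ x ∈ I ] ∑[ a ∈ allFuns 𝔽 (suc n) ] δ (dot a (y x)) t ≡⟨ ∑-cong-∈ I (λ {x} i → hyperplane-𝔽 (y x) t (y₀≢0 i)) ⟩
      ∑[ x ∈ I ] (q ^ n)                                      ≡⟨ ∑-const I (q ^ n) ⟩
      L * q ^ n                                               ∎
      where open ≡-Reasoning

    second-moment : ∀ {t} → ¬ (t ≡ 𝟘) →
                    (∑[ a ∈ allFuns 𝔽 (suc n) ] (incidences a t * incidences a t)) * q ≤ L * (L * q ^ n) + collisions * q ^ suc n
    second-moment {t} t≢0 = begin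
      (∑[ a ∈ U ] (incidences a t * incidences a t)) * q
        ≡⟨ cong (_* q) (∑-cong U (λ a → ∑-product I I _ _)) ⟩
      (∑[ a ∈ U ] ∑[ x ∈ I ] ∑[ x′ ∈ I ] (δ (dot a (y x)) t * δ (dot a (y x′)) t)) * q
        ≡⟨ cong (_* q) (trans (∑-swap U I _) (∑-cong I (λ x → ∑-swap U I _))) ⟩
      (∑[ x ∈ I ] ∑[ x′ ∈ I ] ∑[ a ∈ U ] (δ (dot a (y x)) t * δ (dot a (y x′)) t)) * q
        ≡⟨ trans (sym (∑-*ʳ I q _)) (∑-cong I (λ x → sym (∑-*ʳ I q _))) ⟩
      ∑[ x ∈ I ] ∑[ x′ ∈ I ] ((∑[ a ∈ U ] (δ (dot a (y x)) t * δ (dot a (y x′)) t)) * q)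
        ≤⟨ ∑-mono-∈ I (λ {x} i → ∑-mono-∈ I (λ {x′} i′ → pair-≤ (y x) (y x′) t≢0 (y₀≢0 i) (y₀≢0 i′))) ⟩
      ∑[ x ∈ I ] ∑[ x′ ∈ I ] (q ^ n + eqv (y x) (y x′) * q ^ suc n)
        ≡⟨ ∑-cong I (λ x → trans (∑-+ I _ _) (cong₂ _+_ (∑-const I (q ^ n)) (∑-*ʳ I (q ^ suc n) _))) ⟩
      ∑[ x ∈ I ] (L * q ^ n + (∑[ x′ ∈ I ] eqv (y x) (y x′)) * q ^ suc n)
        ≡⟨ trans (∑-+ I _ _) (cong₂ _+_ (∑-const I (L * q ^ n)) (∑-*ʳ I (q ^ suc n) _)) ⟩
      L * (L * q ^ n) + collisions * q ^ suc n ∎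
      where
      open ≤-Reasoning
      U : List (Fin (suc n) → 𝕂)
      U = allFuns 𝔽 (suc n)

    variance : ∀ {t} → ¬ (t ≡ 𝟘) → ∑[ a ∈ allFuns 𝔽 (suc n) ] discrepancy² a t ≤ q ^ suc (suc n) * collisions
    -- Adding the cross term to both sides makes `dist-square` applicable; afterwards all multiples
    -- of L² cancel and only the collisions remain.
    variance {t} t≢0 = +-cancelʳ-≤ (2 * (q * (L * q ^ n) * L)) _ _ (begin
      ∑[ a ∈ U ] discrepancy² a t + 2 * (q * (L * q ^ n) * L)
        ≡⟨ cong (λ z → ∑ U (λ a → discrepancy² a t) + 2 * (q * z * L)) (sym (first-moment t)) ⟩
      ∑[ a ∈ U ] discrepancy² a t + 2 * (q * (∑[ a ∈ U ] incidences a t) * L)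
        ≡⟨ cong (λ z → ∑ U (λ a → discrepancy² a t) + 2 * z)
             (trans (cong (_* L) (sym (∑-*ˡ U q _))) (sym (∑-*ʳ U L _))) ⟩
      ∑[ a ∈ U ] discrepancy² a t + 2 * ∑[ a ∈ U ] (q * incidences a t * L)
        ≡⟨ cong (∑ U (λ a → discrepancy² a t) +_) (sym (∑-*ˡ U 2 _)) ⟩
      ∑[ a ∈ U ] discrepancy² a t + ∑[ a ∈ U ] (2 * (q * incidences a t * L))
        ≡⟨ sym (∑-+ U _ _) ⟩
      ∑[ a ∈ U ] (discrepancy² a t + 2 * (q * incidences a t * L))
        ≡⟨ ∑-cong U (λ a → trans (dist-square (q * incidences a t) L) (cong (_+ L * L) (square-* q (incidences a t)))) ⟩
      ∑[ a ∈ U ] (q * q * (incidences a t * incidences a t) + L * L)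
        ≡⟨ trans (∑-+ U _ _) (cong₂ _+_ (∑-*ˡ U (q * q) _) (∑-const U (L * L))) ⟩
      q * q * (∑[ a ∈ U ] (incidences a t * incidences a t)) + length U * (L * L)
        ≡⟨ cong₂ _+_ (regroup q _) (cong (_* (L * L)) (trans (length-allFuns 𝔽 (suc n)) (cong (_^ suc n) 𝔽-length))) ⟩
      q * ((∑[ a ∈ U ] (incidences a t * incidences a t)) * q) + q ^ suc n * (L * L)
        ≤⟨ +-monoˡ-≤ _ (*-monoʳ-≤ q (second-moment t≢0)) ⟩
      q * (L * (L * q ^ n) + collisions * q ^ suc n) + q ^ suc n * (L * L)
        ≡⟨ collect q L (q ^ n) collisions ⟩
      q ^ suc (suc n) * collisions + 2 * (q * (L * q ^ n) * L) ∎)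
      where
      open ≤-Reasoning
      U : List (Fin (suc n) → 𝕂)
      U = allFuns 𝔽 (suc n)
      square-* : ∀ a b → a * b * (a * b) ≡ a * a * (b * b)
      square-* = solve-∀
      regroup : ∀ a b → a * a * b ≡ a * (b * a)
      regroup = solve-∀
      collect : ∀ q L b c → q * (L * (L * b) + c * (q * b)) + q * b * (L * L) ≡ q * (q * b) * c + 2 * (q * (L * b) * L)
      collect = solve-∀

    discrepancy-cong : ∀ {a b} t → (∀ i → a i ≡ b i) → discrepancy² a t ≡ discrepancy² b t
    discrepancy-cong t e = cong (λ z → ∣ q * z - L ∣ * ∣ q * z - L ∣)
      (∑-cong I (λ x → cong (λ z → δ z t) (dot-cong {y = y x} e (λ _ → refl))))

    discrepancy-scale : ∀ {t} → ¬ (t ≡ 𝟘) → ∀ a → discrepancy² (λ i → a i ⊗ t) t ≡ discrepancy² a 𝟙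
    discrepancy-scale {t} t≢0 a = cong (λ z → ∣ q * z - L ∣ * ∣ q * z - L ∣) (∑-cong I (λ x →
      trans (cong (λ z → δ z t) (scale (y x))) (δ-cong {dot a (y x) ⊗ t} {t} {dot a (y x)} {𝟙}
        (λ e → ⊗-cancelʳ t≢0 (trans e (sym (R.*-identityˡ t))))
        (λ e → trans (cong (_⊗ t) e) (R.*-identityˡ t)))))
      where
      scale : ∀ w → dot (λ i → a i ⊗ t) w ≡ dot a w ⊗ t
      scale w = trans (sumFin-cong (suc n) {g = λ i → t ⊗ (a i ⊗ w i)} (λ i → trans (cong (_⊗ w i) (R.*-comm (a i) t)) (R.*-assoc t (a i) (w i))))
                  (trans (sumFin-⊗ (suc n) t (λ i → a i ⊗ w i)) (R.*-comm t _))

    -- The zero vector lies on no hyperplane a·y = 1. This is the source of the extra `q * (L * L)`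
    -- in `dilated-variance`.
    discrepancy-zero : ∀ {a} → (∀ i → a i ≡ 𝟘) → discrepancy² a 𝟙 ≡ L * L
    discrepancy-zero {a} e = cong (λ z → z * z) (cong (λ z → ∣ z - L ∣) (trans (cong (q *_) none) (*-zeroʳ q)))
      where
      none : incidences a 𝟙 ≡ 0
      none = trans (∑-cong I (λ x → δ-no (λ e′ → 0≢1 (trans (sym (sumFin-zero (suc n) _
               (λ i → trans (cong (_⊗ y x i) (e i)) (R.zeroˡ _)))) e′))))
               (trans (∑-const I 0) (*-zeroʳ L))

    -- Replacing a by t a turns the hyperplane a·y = t into a·y = 1; a nonzero
    -- a has at most |A| dilates with all coordinates in A.
    dilated-variance : ∀ A → ∑[ t ∈ units ] ∑[ a ∈ allFuns (filterᵇ A 𝔽) (suc n) ] discrepancy² a t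
                             ≤ length (filterᵇ A 𝔽) * (q ^ suc (suc n) * collisions) + q * (L * L)
    dilated-variance A = begin
      ∑[ t ∈ units ] ∑[ a ∈ allFuns (filterᵇ A 𝔽) (suc n) ] discrepancy² a t
        ≡⟨ ∑-cong units (λ t → ∑-allFuns-filter A 𝔽 (suc n) _) ⟩
      ∑[ t ∈ units ] ∑[ a ∈ U ] (χ A a * discrepancy² a t)
        ≡⟨ ∑-cong-∈ units (λ {t} i → sym (𝔽-rescale-vec (∈-units i) (suc n) _
             (λ e → cong₂ _*_ (χ-cong A e) (discrepancy-cong t e)))) ⟩
      ∑[ t ∈ units ] ∑[ a ∈ U ] (χ A (λ i → a i ⊗ t) * discrepancy² (λ i → a i ⊗ t) t)
        ≡⟨ ∑-cong-∈ units (λ {t} i → ∑-cong U (λ a → cong (χ A (λ j → a j ⊗ t) *_) (discrepancy-scale (∈-units i) a))) ⟩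
      ∑[ t ∈ units ] ∑[ a ∈ U ] (χ A (λ i → a i ⊗ t) * discrepancy² a 𝟙)
        ≡⟨ trans (∑-swap units U _) (∑-cong U (λ a → ∑-*ʳ units (discrepancy² a 𝟙) _)) ⟩
      ∑[ a ∈ U ] ((∑[ t ∈ units ] χ A (λ i → a i ⊗ t)) * discrepancy² a 𝟙)
        ≤⟨ ∑-mono U (λ a → *-monoˡ-≤ (discrepancy² a 𝟙) (χ-dilates A a)) ⟩
      ∑[ a ∈ U ] ((k + q * eqv a (λ _ → 𝟘)) * discrepancy² a 𝟙)
        ≡⟨ ∑-cong U (λ a → expand k q (eqv a (λ _ → 𝟘)) (discrepancy² a 𝟙)) ⟩
      ∑[ a ∈ U ] (k * discrepancy² a 𝟙 + q * (eqv a (λ _ → 𝟘) * discrepancy² a 𝟙))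
        ≡⟨ trans (∑-+ U _ _) (cong₂ _+_ (∑-*ˡ U k _) (∑-*ˡ U q _)) ⟩
      k * (∑[ a ∈ U ] discrepancy² a 𝟙) + q * (∑[ a ∈ U ] (eqv a (λ _ → 𝟘) * discrepancy² a 𝟙))
        ≤⟨ +-mono-≤ (*-monoʳ-≤ k (variance (λ e → 0≢1 (sym e)))) (*-monoʳ-≤ q origin) ⟩
      k * (q ^ suc (suc n) * collisions) + q * (L * L) ∎
      where
      open ≤-Reasoning
      k : ℕ
      k = length (filterᵇ A 𝔽)
      U : List (Fin (suc n) → 𝕂)
      U = allFuns 𝔽 (suc n)
      expand : ∀ k q e d → (k + q * e) * d ≡ k * d + q * (e * d)
      expand = solve-∀
      at : ∀ a → eqv a (λ _ → 𝟘) * discrepancy² a 𝟙 ≤ eqv a (λ _ → 𝟘) * (L * L)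
      at a with eqv-cases a (λ _ → 𝟘)
      ... | inj₁ e = *-monoʳ-≤ (eqv a (λ _ → 𝟘)) (≤-reflexive (discrepancy-zero e))
      ... | inj₂ z = ≤-trans (≤-reflexive (cong (_* discrepancy² a 𝟙) z)) z≤n
      origin : ∑[ a ∈ U ] (eqv a (λ _ → 𝟘) * discrepancy² a 𝟙) ≤ L * L
      origin = begin
        ∑[ a ∈ U ] (eqv a (λ _ → 𝟘) * discrepancy² a 𝟙) ≤⟨ ∑-mono U at ⟩
        ∑[ a ∈ U ] (eqv a (λ _ → 𝟘) * (L * L))          ≡⟨ ∑-*ʳ U (L * L) _ ⟩
        ∑[ a ∈ U ] eqv a (λ _ → 𝟘) * (L * L)            ≤⟨ *-monoˡ-≤ (L * L) (∑-eqv-≤1 𝔽 𝔽-nodup {suc n} (λ _ → 𝟘)) ⟩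
        1 * (L * L)                                     ≡⟨ *-identityˡ (L * L) ⟩
        L * L                                           ∎

-- Matrices with entries in A

module Matrices (F : FiniteField) (odd : OddCharacteristic F) (A : Carrier F → Bool) where
  open Field F
  open Count F
  open Variance F
  open Field.Odd F odd

  As : List 𝕂
  As = filterᵇ A 𝔽

  k : ℕ
  k = length As

  As-nodup : Nodup As
  As-nodup = filter-nodup A

  Mat : ∀ m n → List (Fin m → Fin n → 𝕂)
  Mat m n = allFuns (allFuns As n) m

  -- Agrees with `N` by `N-cnt`, but enumerates matrices over the list of elements of A, so that
  -- sums split by rows.
  cnt : ∀ n → 𝕂 → ℕ
  cnt n t = ∑[ M ∈ Mat n n ] δ (Det n M) t

  ⟦∧⟧ : ∀ b c → ⟦ b ∧ c ⟧ ≡ ⟦ b ⟧ * ⟦ c ⟧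
  ⟦∧⟧ true  c = sym (+-identityʳ ⟦ c ⟧)
  ⟦∧⟧ false c = refl

  ⟦allB⟧ : ∀ (p : X → Bool) (a : Y → X) {n} (g : Fin n → Y) →
           ⟦ allB (λ i → p (a i)) (tabulate g) ⟧ ≡ χ p (λ i → a (g i))
  ⟦allB⟧ p a {zero}  g = refl
  ⟦allB⟧ p a {suc n} g = trans (⟦∧⟧ (p (a (g zero))) _) (cong (⟦ p (a (g zero)) ⟧ *_) (⟦allB⟧ p a (λ i → g (suc i))))

  N-cnt : ∀ d t → N F d A t ≡ cnt d t
  N-cnt d t = begin
    N F d A t
      ≡⟨ length-filter _ (allMatrices d) ⟩
    ∑[ M ∈ allMatrices d ] ⟦ allEntriesIn A d M ∧ ⌊ Det d M ≟ t ⌋ ⟧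
      ≡⟨ ∑-cong (allMatrices d) (λ M → trans (⟦∧⟧ (allEntriesIn A d M) _) (cong (_* δ (Det d M) t) (entries M))) ⟩
    ∑[ M ∈ allMatrices d ] (∏ (χ A) M * δ (Det d M) t)
      ≡⟨ sym (∑-allFuns-weighted (∑-allFuns-filter A 𝔽 d) d _) ⟩
    cnt d t ∎
    where
    open ≡-Reasoning
    entries : ∀ M → ⟦ allEntriesIn A d M ⟧ ≡ ∏ (χ A) M
    entries M = trans (⟦allB⟧ (λ r → allB (λ j → A (r j)) (allFin d)) M (λ i → i)) (∏-cong (λ r → ⟦allB⟧ A r (λ j → j)) M)

  -- Matrices are enumerated by rows, while the determinant expands along the first column.
  -- Exchanging sums row by row detaches that column; the reassembled matrix agrees with the
  -- original only pointwise, hence the premise on f.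
  ∑-columns : ∀ m n (f : (Fin m → Fin (suc n) → 𝕂) → ℕ) → (∀ {M M′} → (∀ i j → M i j ≡ M′ i j) → f M ≡ f M′) →
              ∑ (Mat m (suc n)) f ≡ ∑[ a ∈ allFuns As m ] ∑[ M ∈ Mat m n ] f (λ i → a i ∷ᶠ M i)
  ∑-columns zero    n f ext = trans (cong (_+ 0) (ext λ ())) (sym (+-identityʳ _))
  ∑-columns (suc m) n f ext = begin
    ∑ (Mat (suc m) (suc n)) f
      ≡⟨ trans (∑-allFuns (allFuns As (suc n)) m f) (∑-allFuns As n _) ⟩
    ∑[ x ∈ As ] ∑[ r ∈ allFuns As n ] ∑[ M ∈ Mat m (suc n) ] f ((x ∷ᶠ r) ∷ᶠ M)
      ≡⟨ ∑-cong As (λ x → ∑-cong (allFuns As n) (λ r → ∑-columns m n (λ M → f ((x ∷ᶠ r) ∷ᶠ M))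
           (λ e → ext λ { zero j → refl ; (suc i) j → e i j }))) ⟩
    ∑[ x ∈ As ] ∑[ r ∈ allFuns As n ] ∑[ a ∈ allFuns As m ] ∑[ M ∈ Mat m n ] f ((x ∷ᶠ r) ∷ᶠ (λ i → a i ∷ᶠ M i))
      ≡⟨ ∑-cong As (λ x → ∑-swap (allFuns As n) (allFuns As m) _) ⟩
    ∑[ x ∈ As ] ∑[ a ∈ allFuns As m ] ∑[ r ∈ allFuns As n ] ∑[ M ∈ Mat m n ] f ((x ∷ᶠ r) ∷ᶠ (λ i → a i ∷ᶠ M i))
      ≡⟨ ∑-cong As (λ x → ∑-cong (allFuns As m) (λ a → ∑-cong (allFuns As n) (λ r → ∑-cong (Mat m n) (λ M →
           ext λ { zero j → refl ; (suc i) j → refl })))) ⟩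
    ∑[ x ∈ As ] ∑[ a ∈ allFuns As m ] ∑[ r ∈ allFuns As n ] ∑[ M ∈ Mat m n ] f (λ i → (x ∷ᶠ a) i ∷ᶠ (r ∷ᶠ M) i)
      ≡⟨ ∑-cong As (λ x → ∑-cong (allFuns As m) (λ a → sym (∑-allFuns (allFuns As n) m _))) ⟩
    ∑[ x ∈ As ] ∑[ a ∈ allFuns As m ] ∑[ M ∈ Mat (suc m) n ] f (λ i → (x ∷ᶠ a) i ∷ᶠ M i)
      ≡⟨ sym (∑-allFuns As m _) ⟩
    ∑[ a ∈ allFuns As (suc m) ] ∑[ M ∈ Mat (suc m) n ] f (λ i → a i ∷ᶠ M i) ∎
    where open ≡-Reasoning

  V : ℕ → ℕ
  V n = (k ^ n) ^ n

  length-Mat : ∀ m n → length (Mat m n) ≡ (k ^ n) ^ m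
  length-Mat m n = trans (length-allFuns (allFuns As n) m) (cong (_^ m) (length-allFuns As n))

  V-suc : ∀ n → V (suc n) ≡ k * k ^ n * (k ^ n * V n)
  V-suc n = cong (k * k ^ n *_) (^-distribʳ-* k (k ^ n) n)

  cnt-split : ∀ n t → cnt (suc n) t ≡ ∑[ a ∈ allFuns As (suc n) ] ∑[ M ∈ Mat (suc n) n ] δ (dot a (cofactors M)) t
  cnt-split n t = trans
    (∑-columns (suc n) n (λ M → δ (Det (suc n) M) t) (λ e → cong (λ z → δ z t) (Det-cong (suc n) e)))
    (∑-cong (allFuns As (suc n)) (λ a → ∑-cong (Mat (suc n) n) (λ M → cong (λ z → δ z t) (Det-dot a M))))

  ∑-δ≡1 : ∀ s → ∑[ t ∈ 𝔽 ] δ s t ≡ 1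
  ∑-δ≡1 s = trans (∑-cong 𝔽 (λ t → sym (*-identityʳ (δ s t)))) (𝔽-pick s (λ _ → 1))

  -- Splitting off the first column

  module Step (n : ℕ) where

    singular? : (Fin n → Fin n → 𝕂) → Bool
    singular? P = ⌊ Det n P ≟ 𝟘 ⌋

    -- The numbers of first rows without their first entry, of first columns, and of singular
    -- minors.
    B U Z : ℕ
    B = k ^ n
    U = k * B
    Z = cnt n 𝟘

    -- The split is by the minor below the first row, which is the cofactor y₀. Both the variance
    -- bound and the recovery of the first row use y₀ ≠ 0.
    Regular Singular : List (Fin (suc n) → Fin n → 𝕂)
    Regular  = filterᵇ (λ M → not (singular? (λ i → M (suc i)))) (Mat (suc n) n)
    Singular = filterᵇ (λ M → singular? (λ i → M (suc i))) (Mat (suc n) n)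

    RegularMinor : List (Fin n → Fin n → 𝕂)
    RegularMinor = filterᵇ (λ P → not (singular? P)) (Mat n n)

    nonsingular : ∀ {P : Fin n → Fin n → 𝕂} → not (singular? P) ≡ true → ¬ (Det n P ≡ 𝟘)
    nonsingular {P} e d≡0 with Det n P ≟ 𝟘
    nonsingular () d≡0 | yes _
    ... | no ne = ne d≡0

    cofactors-nonzero : ∀ {M} → M ∈ Regular → ¬ (cofactors M zero ≡ 𝟘)
    cofactors-nonzero {M} i e = nonsingular (∈-filterᵇ _ (Mat (suc n) n) i) (trans (sym (R.*-identityˡ _)) e)

    open Incidence Regular cofactors cofactors-nonzero public

    tuples-length : length (allFuns As (suc n)) ≡ U
    tuples-length = length-allFuns As (suc n)

    regular singular : 𝕂 → ℕ
    regular  t = ∑[ a ∈ allFuns As (suc n) ] ∑[ M ∈ Regular ] δ (dot a (cofactors M)) t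
    singular t = ∑[ a ∈ allFuns As (suc n) ] ∑[ M ∈ Singular ] δ (dot a (cofactors M)) t

    cnt-partition : ∀ t → cnt (suc n) t ≡ regular t + singular t
    cnt-partition t = trans (cnt-split n t) (trans
      (∑-cong (allFuns As (suc n)) (λ a → ∑-partition (λ M → singular? (λ i → M (suc i))) (Mat (suc n) n) _))
      (∑-+ (allFuns As (suc n)) _ _))

    length-Singular : length Singular ≡ B * Z
    length-Singular = begin
      length Singular
        ≡⟨ length-filter _ (Mat (suc n) n) ⟩
      ∑[ M ∈ Mat (suc n) n ] ⟦ singular? (λ i → M (suc i)) ⟧
        ≡⟨ ∑-allFuns (allFuns As n) n _ ⟩
      ∑[ c ∈ allFuns As n ] Z
        ≡⟨ trans (∑-const (allFuns As n) Z) (cong (_* Z) (length-allFuns As n)) ⟩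
      B * Z ∎
      where open ≡-Reasoning

    L+Singular : L + B * Z ≡ B * V n
    L+Singular = begin
      L + B * Z
        ≡⟨ cong₂ _+_ (sym (∑-one Regular)) (trans (sym length-Singular) (sym (∑-one Singular))) ⟩
      ∑ Regular (λ _ → 1) + ∑ Singular (λ _ → 1)
        ≡⟨ sym (∑-partition (λ M → singular? (λ i → M (suc i))) (Mat (suc n) n) (λ _ → 1)) ⟩
      ∑[ _ ∈ Mat (suc n) n ] 1
        ≡⟨ trans (∑-one (Mat (suc n) n)) (length-Mat (suc n) n) ⟩
      B * V n ∎
      where open ≡-Reasoning

    -- For each fixed M the admissible first columns lie on a hyperplane, which contains at most a
    -- share 1/|A| of all columns over A.
    column-bound : ∀ (J : List (Fin (suc n) → Fin n → 𝕂)) t →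
                   (∀ {M} → M ∈ J → ¬ (t ≡ 𝟘 × (∀ i → cofactors M i ≡ 𝟘))) →
                   (∑[ a ∈ allFuns As (suc n) ] ∑[ M ∈ J ] δ (dot a (cofactors M)) t) * k ≤ U * length J
    column-bound J t nontrivial = begin
      (∑[ a ∈ allFuns As (suc n) ] ∑[ M ∈ J ] δ (dot a (cofactors M)) t) * k
        ≡⟨ trans (cong (_* k) (∑-swap (allFuns As (suc n)) J _)) (sym (∑-*ʳ J k _)) ⟩
      ∑[ M ∈ J ] ((∑[ a ∈ allFuns As (suc n) ] δ (dot a (cofactors M)) t) * k)
        ≤⟨ ∑-mono-∈ J (λ {M} i → hyperplane-≤ As As-nodup (cofactors M) t (nontrivial i)) ⟩
      ∑[ M ∈ J ] U
        ≡⟨ trans (∑-const J U) (*-comm (length J) U) ⟩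
      U * length J ∎
      where open ≤-Reasoning

    -- Each pair of a and M has one determinant, so the sum over t counts it at most once.
    total-bound : ∀ (J : List (Fin (suc n) → Fin n → 𝕂)) →
                  ∑[ t ∈ units ] ∑[ a ∈ allFuns As (suc n) ] ∑[ M ∈ J ] δ (dot a (cofactors M)) t ≤ U * length J
    total-bound J = begin
      ∑[ t ∈ units ] ∑[ a ∈ allFuns As (suc n) ] ∑[ M ∈ J ] δ (dot a (cofactors M)) t
        ≤⟨ ∑-filter-≤ _ 𝔽 _ ⟩
      ∑[ t ∈ 𝔽 ] ∑[ a ∈ allFuns As (suc n) ] ∑[ M ∈ J ] δ (dot a (cofactors M)) t
        ≡⟨ trans (∑-swap 𝔽 (allFuns As (suc n)) _) (∑-cong (allFuns As (suc n)) (λ a →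
             trans (∑-swap 𝔽 J _) (∑-cong J (λ M → ∑-δ≡1 (dot a (cofactors M)))))) ⟩
      ∑[ a ∈ allFuns As (suc n) ] ∑[ M ∈ J ] 1
        ≡⟨ trans (∑-const (allFuns As (suc n)) _) (cong₂ _*_ tuples-length (∑-one J)) ⟩
      U * length J ∎
      where open ≤-Reasoning

    singular-bound : ∀ {t} → ¬ (t ≡ 𝟘) → singular t * k ≤ U * (B * Z)
    singular-bound {t} t≢0 = ≤-trans (column-bound Singular t (λ _ z → t≢0 (proj₁ z))) (≤-reflexive (cong (U *_) length-Singular))

    singular-total : ∑ units singular ≤ U * (B * Z)
    singular-total = ≤-trans (total-bound Singular) (≤-reflexive (cong (U *_) length-Singular))

    -- Over a nonsingular minor, vanishing of the determinant is a genuine hyperplane condition on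
    -- the first column. Singular minors are counted without any saving, which makes this a
    -- recursion in n.
    zero-count : cnt (suc n) 𝟘 * k ≤ V (suc n) + U * (B * (Z * k))
    zero-count = begin
      cnt (suc n) 𝟘 * k                      ≡⟨ trans (cong (_* k) (cnt-partition 𝟘)) (*-distribʳ-+ k (regular 𝟘) (singular 𝟘)) ⟩
      regular 𝟘 * k + singular 𝟘 * k         ≤⟨ +-mono-≤ (column-bound Regular 𝟘 (λ i z → cofactors-nonzero i (proj₂ z zero))) (*-monoˡ-≤ k trivial) ⟩
      U * L + U * (B * Z) * k                ≤⟨ +-monoˡ-≤ _ (*-monoʳ-≤ U (≤-trans (m≤m+n L (B * Z)) (≤-reflexive L+Singular))) ⟩
      U * (B * V n) + U * (B * Z) * k        ≡⟨ cong₂ _+_ (sym (V-suc n)) (assoc U B Z k) ⟩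
      V (suc n) + U * (B * (Z * k))          ∎
      where
      open ≤-Reasoning
      assoc : ∀ u b z k → u * (b * z) * k ≡ u * (b * (z * k))
      assoc = solve-∀
      trivial : singular 𝟘 ≤ U * (B * Z)
      trivial = begin
        singular 𝟘
          ≤⟨ ∑-mono (allFuns As (suc n)) (λ a → ∑-mono Singular (λ M → δ-≤1 _ 𝟘)) ⟩
        ∑[ a ∈ allFuns As (suc n) ] ∑[ M ∈ Singular ] 1
          ≡⟨ trans (∑-const (allFuns As (suc n)) _) (cong₂ _*_ tuples-length (trans (∑-one Singular) length-Singular)) ⟩
        U * (B * Z) ∎

    cnt-bound : ∀ {t} → ¬ (t ≡ 𝟘) → cnt (suc n) t * k ≤ V (suc n)
    cnt-bound {t} t≢0 = begin
      cnt (suc n) t * k ≡⟨ cong (_* k) (cnt-split n t) ⟩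
      _                 ≤⟨ column-bound (Mat (suc n) n) t (λ _ z → t≢0 (proj₁ z)) ⟩
      U * length (Mat (suc n) n) ≡⟨ trans (cong (U *_) (length-Mat (suc n) n)) (sym (V-suc n)) ⟩
      V (suc n)         ∎
      where open ≤-Reasoning

    cnt-total : ∑ units (cnt (suc n)) ≤ V (suc n)
    cnt-total = begin
      ∑ units (cnt (suc n)) ≡⟨ ∑-cong units (cnt-split n) ⟩
      _                     ≤⟨ total-bound (Mat (suc n) n) ⟩
      U * length (Mat (suc n) n) ≡⟨ trans (cong (U *_) (length-Mat (suc n) n)) (sym (V-suc n)) ⟩
      V (suc n)             ∎
      where open ≤-Reasoning

    -- The triangle inequality sums the deviations over the first columns, and Cauchy-Schwarz passes
    -- to squares at the cost of a factor `U`.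
    regular-deviation : ∀ t → ∣ q * regular t - U * L ∣ * ∣ q * regular t - U * L ∣ ≤
                              U * ∑[ a ∈ allFuns As (suc n) ] discrepancy² a t
    regular-deviation t = begin
      ∣ q * regular t - U * L ∣ * ∣ q * regular t - U * L ∣
        ≤⟨ *-mono-≤ sum-dist sum-dist ⟩
      (∑[ a ∈ allFuns As (suc n) ] discrepancy a t) * (∑[ a ∈ allFuns As (suc n) ] discrepancy a t)
        ≤⟨ cauchy-schwarz (allFuns As (suc n)) (λ a → discrepancy a t) ⟩
      length (allFuns As (suc n)) * ∑[ a ∈ allFuns As (suc n) ] discrepancy² a t
        ≡⟨ cong (_* ∑ (allFuns As (suc n)) (λ a → discrepancy² a t)) tuples-length ⟩
      U * ∑[ a ∈ allFuns As (suc n) ] discrepancy² a t ∎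
      where
      open ≤-Reasoning
      sum-dist : ∣ q * regular t - U * L ∣ ≤ ∑[ a ∈ allFuns As (suc n) ] discrepancy a t
      sum-dist = begin
        ∣ q * regular t - U * L ∣
          ≡⟨ cong₂ ∣_-_∣ (sym (∑-*ˡ (allFuns As (suc n)) q (λ a → incidences a t)))
                         (sym (trans (∑-const (allFuns As (suc n)) L) (cong (_* L) tuples-length))) ⟩
        ∣ ∑[ a ∈ allFuns As (suc n) ] (q * incidences a t) - ∑[ _ ∈ allFuns As (suc n) ] L ∣
          ≤⟨ ∑-dist (allFuns As (suc n)) _ _ ⟩
        ∑[ a ∈ allFuns As (suc n) ] discrepancy a t ∎

    regular-pointwise : ∀ {t} → ¬ (t ≡ 𝟘) → ∣ q * regular t - U * L ∣ * ∣ q * regular t - U * L ∣ ≤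
                                            U * (q ^ suc (suc n) * collisions)
    regular-pointwise {t} t≢0 = ≤-trans (regular-deviation t)
      (*-monoʳ-≤ U (≤-trans (∑-allFuns-filter-≤ A 𝔽 (suc n) (λ a → discrepancy² a t)) (variance t≢0)))

    -- Each `q * regular t` is at most its deviation plus the main term `U * L`; the deviations are
    -- summed by `dilated-variance`, the main term over at most q values of t.
    regular-squares : q * q * ∑[ t ∈ units ] (regular t * regular t) ≤
                      2 * (U * (k * (q ^ suc (suc n) * collisions) + q * (L * L))) + q * (2 * (U * L * (U * L)))
    regular-squares = begin
      q * q * ∑[ t ∈ units ] (regular t * regular t)
        ≡⟨ sym (∑-*ˡ units (q * q) _) ⟩
      ∑[ t ∈ units ] (q * q * (regular t * regular t))
        ≤⟨ ∑-mono units pointwise ⟩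
      ∑[ t ∈ units ] (2 * (U * S t) + 2 * (U * L * (U * L)))
        ≡⟨ trans (∑-+ units _ _) (cong₂ _+_ (trans (∑-*ˡ units 2 _) (cong (2 *_) (∑-*ˡ units U S))) (∑-const units _)) ⟩
      2 * (U * ∑ units S) + length units * (2 * (U * L * (U * L)))
        ≤⟨ +-mono-≤ (*-monoʳ-≤ 2 (*-monoʳ-≤ U (dilated-variance A))) (*-monoˡ-≤ _ length-units) ⟩
      2 * (U * (k * (q ^ suc (suc n) * collisions) + q * (L * L))) + q * (2 * (U * L * (U * L))) ∎
      where
      open ≤-Reasoning
      S : 𝕂 → ℕ
      S t = ∑[ a ∈ allFuns As (suc n) ] discrepancy² a t
      square-* : ∀ a b → a * a * (b * b) ≡ a * b * (a * b)
      square-* = solve-∀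
      pointwise : ∀ t → q * q * (regular t * regular t) ≤ 2 * (U * S t) + 2 * (U * L * (U * L))
      pointwise t = begin
        q * q * (regular t * regular t)         ≡⟨ square-* q (regular t) ⟩
        q * regular t * (q * regular t)         ≤⟨ *-mono-≤ le le ⟩
        (D + U * L) * (D + U * L)               ≤⟨ square-+ D (U * L) ⟩
        2 * (D * D) + 2 * (U * L * (U * L))     ≤⟨ +-monoˡ-≤ _ (*-monoʳ-≤ 2 (regular-deviation t)) ⟩
        2 * (U * S t) + 2 * (U * L * (U * L))   ∎
        where
        D : ℕ
        D = ∣ q * regular t - U * L ∣
        le : q * regular t ≤ D + U * L
        le = ≤-trans (m≤n+∣m-n∣ (q * regular t) (U * L)) (≤-reflexive (+-comm (U * L) D))

    -- The second moment of the determinant over nonzero values; equivalently, the number of pairs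
    -- of nonsingular matrices with equal determinant.
    W : ℕ
    W = ∑[ t ∈ units ] (cnt n t * cnt n t)

    ∑-Regular : ∀ (f : (Fin (suc n) → Fin n → 𝕂) → ℕ) →
                ∑ Regular f ≡ ∑[ c ∈ allFuns As n ] ∑[ P ∈ RegularMinor ] f (c ∷ᶠ P)
    ∑-Regular f = trans (∑-filter _ (Mat (suc n) n) f) (trans (∑-allFuns (allFuns As n) n _)
      (∑-cong (allFuns As n) (λ c → sym (∑-filter _ (Mat n n) _))))

    equal-determinants : ∑[ P ∈ RegularMinor ] ∑[ P′ ∈ RegularMinor ] δ (Det n P) (Det n P′) ≤ W
    equal-determinants = begin
      ∑[ P ∈ RegularMinor ] ∑[ P′ ∈ RegularMinor ] δ (Det n P) (Det n P′)
        ≤⟨ ∑-mono RegularMinor (λ P → ∑-filter-≤ _ (Mat n n) _) ⟩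
      ∑[ P ∈ RegularMinor ] ∑[ P′ ∈ Mat n n ] δ (Det n P) (Det n P′)
        ≡⟨ ∑-filter _ (Mat n n) _ ⟩
      ∑[ P ∈ Mat n n ] (⟦ not (singular? P) ⟧ * ∑[ P′ ∈ Mat n n ] δ (Det n P) (Det n P′))
        ≡⟨ ∑-cong (Mat n n) (λ P → trans (cong (⟦ not (singular? P) ⟧ *_)
             (∑-cong (Mat n n) (λ P′ → δ-cong {Det n P} {Det n P′} {Det n P′} {Det n P} sym sym)))
             (sym (𝔽-pick (Det n P) (λ t → ⟦ not ⌊ t ≟ 𝟘 ⌋ ⟧ * cnt n t)))) ⟩
      ∑[ P ∈ Mat n n ] ∑[ t ∈ 𝔽 ] (δ (Det n P) t * (⟦ not ⌊ t ≟ 𝟘 ⌋ ⟧ * cnt n t))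
        ≡⟨ trans (∑-swap (Mat n n) 𝔽 _) (∑-cong 𝔽 (λ t → trans (∑-*ʳ (Mat n n) _ (λ P → δ (Det n P) t)) (exchange (cnt n t) ⟦ not ⌊ t ≟ 𝟘 ⌋ ⟧))) ⟩
      ∑[ t ∈ 𝔽 ] (⟦ not ⌊ t ≟ 𝟘 ⌋ ⟧ * (cnt n t * cnt n t))
        ≡⟨ sym (∑-filter _ 𝔽 _) ⟩
      W ∎
      where
      open ≤-Reasoning
      exchange : ∀ c b → c * (b * c) ≡ b * (c * c)
      exchange = solve-∀

    -- The cofactors and a nonsingular minor P′ determine the first row.
    fibre-bound : ∀ c P P′ → ¬ (Det n P ≡ 𝟘) →
                  ∑[ c′ ∈ allFuns As n ] eqv (cofactors (c ∷ᶠ P)) (cofactors (c′ ∷ᶠ P′)) ≤ δ (Det n P) (Det n P′)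
    fibre-bound c P P′ d≢0 with Det n P ≟ Det n P′
    -- The zeroth cofactor is the determinant of the minor, so unequal determinants exclude a
    -- collision.
    ... | no ne = ≤-trans (∑-mono (allFuns As n) {g = λ _ → 0} (λ c′ → eqv-≤ {u = cofactors (c ∷ᶠ P)} {cofactors (c′ ∷ᶠ P′)} {0} (λ e →
          ⊥-elim (ne (trans (sym (R.*-identityˡ _)) (trans (e zero) (R.*-identityˡ _)))))))
          (≤-reflexive (trans (∑-const (allFuns As n) 0) (*-zeroʳ (length (allFuns As n)))))
    ... | yes _ with inverse (Det n P) d≢0
    ...   | z , dz≡1 = ≤-trans (∑-mono (allFuns As n) (λ c′ → eqv-≤ {u = cofactors (c ∷ᶠ P)} {cofactors (c′ ∷ᶠ P′)} (λ e →
            ≤-reflexive (sym (eqv-yes {u = c′} {v} (firstRow-determined c′ P′ {cofactors (c ∷ᶠ P)} {z} (λ i → sym (e i))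
              (trans (cong (_⊗ z) (R.*-identityˡ _)) dz≡1)))))))
            (∑-eqv-≤1 As As-nodup v)
      where
      v : Fin n → 𝕂
      v j = ⊖ dot (λ i → P′ i j) (λ i → cofactors (c ∷ᶠ P) (suc i)) ⊗ z

    -- For given c, P and P′ at most one c′ remains, so the free data are one row and a pair of
    -- minors of equal determinant.
    collisions-bound : collisions ≤ B * W
    collisions-bound = begin
      collisions
        ≡⟨ trans (∑-Regular _) (∑-cong Rows (λ c → ∑-cong RegularMinor (λ P → trans (∑-Regular _) (∑-swap Rows RegularMinor _)))) ⟩
      ∑[ c ∈ Rows ] ∑[ P ∈ RegularMinor ] ∑[ P′ ∈ RegularMinor ] ∑[ c′ ∈ Rows ] eqv (cofactors (c ∷ᶠ P)) (cofactors (c′ ∷ᶠ P′))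
        ≤⟨ ∑-mono Rows (λ c → ∑-mono-∈ RegularMinor (λ {P} i → ∑-mono RegularMinor (λ P′ →
             fibre-bound c P P′ (nonsingular (∈-filterᵇ _ (Mat n n) i))))) ⟩
      ∑[ c ∈ Rows ] ∑[ P ∈ RegularMinor ] ∑[ P′ ∈ RegularMinor ] δ (Det n P) (Det n P′)
        ≤⟨ ∑-mono Rows (λ _ → equal-determinants) ⟩
      ∑[ c ∈ Rows ] W
        ≡⟨ trans (∑-const Rows W) (cong (_* W) (length-allFuns As n)) ⟩
      B * W ∎
      where
      open ≤-Reasoning
      Rows : List (Fin n → 𝕂)
      Rows = allFuns As n

    W-suc : ∑[ t ∈ units ] (cnt (suc n) t * cnt (suc n) t) ≤
            2 * ∑[ t ∈ units ] (regular t * regular t) + 2 * ∑[ t ∈ units ] (singular t * singular t)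
    W-suc = begin
      ∑[ t ∈ units ] (cnt (suc n) t * cnt (suc n) t)
        ≤⟨ ∑-mono units (λ t → ≤-trans (≤-reflexive (cong (λ z → z * z) (cnt-partition t))) (square-+ (regular t) (singular t))) ⟩
      ∑[ t ∈ units ] (2 * (regular t * regular t) + 2 * (singular t * singular t))
        ≡⟨ trans (∑-+ units _ _) (cong₂ _+_ (∑-*ˡ units 2 _) (∑-*ˡ units 2 _)) ⟩
      2 * ∑[ t ∈ units ] (regular t * regular t) + 2 * ∑[ t ∈ units ] (singular t * singular t) ∎
      where open ≤-Reasoning

-- Recursion for the second moment

triangle : ℕ → ℕ
triangle zero    = 0
triangle (suc n) = n + triangle n

-- `triangle n` is n(n - 1)/2, the exponent of q accumulated by a factor q^n at each step; doubling
-- avoids the division.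
2*triangle : ∀ n → 2 * triangle n + n ≡ n * n
2*triangle zero    = refl
2*triangle (suc n) = trans (shift n (triangle n)) (trans (cong (λ z → z + (n + suc n)) (2*triangle n)) (close n))
  where
  shift : ∀ n t → 2 * (n + t) + suc n ≡ 2 * t + n + (n + suc n)
  shift = solve-∀
  close : ∀ n → n * n + (n + suc n) ≡ suc n * suc n
  close = solve-∀

-- Both constants, the factor 4 and the summand 8 + 2n², come from `W-step`.
bound : ℕ → ℕ
bound zero    = 1
bound (suc n) = 4 * bound n + (8 + 2 * (n * n))

bound≥1 : ∀ n → 1 ≤ bound n
bound≥1 zero    = s≤s z≤n
bound≥1 (suc n) = ≤-trans (bound≥1 n) (≤-trans (m≤n*m (bound n) 4) (m≤m+n (4 * bound n) _))

module Recursion (F : FiniteField) (odd : OddCharacteristic F) (A : Carrier F → Bool)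
                 (0<k : 0 < card F A) (q≤k² : FiniteField.size F ≤ card F A * card F A) where
  open Field F
  open Count F
  open Variance F
  open Matrices F odd A

  0<q : 0 < q
  0<q = ≤-<-trans z≤n (toℕ<n (Inverse.to enum 𝟘))

  instance
    k-nonZero : NonZero k
    k-nonZero = >-nonZero 0<k
    q-nonZero : NonZero q
    q-nonZero = >-nonZero 0<q

  W : ℕ → ℕ
  W n = Step.W n

  -- Unrolling `zero-count` contributes one `V` per dimension; the empty matrix, of determinant 1,
  -- starts the count at zero.
  zero-det-bound : ∀ n → cnt n 𝟘 * k ≤ n * V n
  zero-det-bound zero    = ≤-trans (≤-reflexive (cong (λ z → (z + 0) * k) (δ-no {𝟙} {𝟘} (λ e → 0≢1 (sym e))))) z≤n
  zero-det-bound (suc n) = begin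
    cnt (suc n) 𝟘 * k                            ≤⟨ zero-count ⟩
    V (suc n) + U * (B * (Z * k))                ≤⟨ +-monoʳ-≤ (V (suc n)) (*-monoʳ-≤ U (*-monoʳ-≤ B (zero-det-bound n))) ⟩
    V (suc n) + U * (B * (n * V n))              ≡⟨ cong (V (suc n) +_) (trans (pull U B n (V n)) (cong (n *_) (sym (V-suc n)))) ⟩
    suc n * V (suc n)                            ∎
    where
    open ≤-Reasoning
    open Step n
    pull : ∀ u b n v → u * (b * (n * v)) ≡ n * (u * (b * v))
    pull = solve-∀

  UBZk-bound : ∀ n → k * k ^ n * (k ^ n * cnt n 𝟘) * k ≤ n * V (suc n)
  UBZk-bound n = begin
    U * (B * Z) * k       ≡⟨ assoc U B Z k ⟩
    U * (B * (Z * k))     ≤⟨ *-monoʳ-≤ U (*-monoʳ-≤ B (zero-det-bound n)) ⟩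
    U * (B * (n * V n))   ≡⟨ trans (pull U B n (V n)) (cong (n *_) (sym (V-suc n))) ⟩
    n * V (suc n)         ∎
    where
    open ≤-Reasoning
    open Step n
    assoc : ∀ u b z k → u * (b * z) * k ≡ u * (b * (z * k))
    assoc = solve-∀
    pull : ∀ u b n v → u * (b * (n * v)) ≡ n * (u * (b * v))
    pull = solve-∀

  -- Two savings of |A|: the hyperplane condition on the first column and the scarcity of singular
  -- minors.
  singular-pointwise : ∀ n {t} → ¬ (t ≡ 𝟘) → Step.singular n t * (k * k) ≤ n * V (suc n)
  singular-pointwise n {t} t≢0 = begin
    singular t * (k * k)   ≡⟨ sym (*-assoc (singular t) k k) ⟩
    singular t * k * k     ≤⟨ *-monoˡ-≤ k (singular-bound t≢0) ⟩
    U * (B * Z) * k        ≤⟨ UBZk-bound n ⟩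
    n * V (suc n)          ∎
    where
    open ≤-Reasoning
    open Step n

  -- Maximum times total. The hypothesis q ≤ k² trades `q * k` for k³, which matches the savings
  -- available: k² pointwise and k in the total.
  singular-squares : ∀ n → q * k * ∑[ t ∈ units ] (Step.singular n t * Step.singular n t) ≤ n * n * (V (suc n) * V (suc n))
  singular-squares n = begin
    q * k * ∑ units (λ t → singular t * singular t)
      ≤⟨ *-monoˡ-≤ _ (*-monoˡ-≤ k q≤k²) ⟩
    k * k * k * ∑ units (λ t → singular t * singular t)
      ≡⟨ sym (∑-*ˡ units (k * k * k) _) ⟩
    ∑[ t ∈ units ] (k * k * k * (singular t * singular t))
      ≡⟨ ∑-cong units (λ t → regroup k (singular t)) ⟩
    ∑[ t ∈ units ] (singular t * (k * k) * (singular t * k))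
      ≤⟨ ∑-mono-∈ units (λ {t} i → *-monoˡ-≤ (singular t * k) (singular-pointwise n (∈-units i))) ⟩
    ∑[ t ∈ units ] (n * V (suc n) * (singular t * k))
      ≡⟨ trans (∑-*ˡ units (n * V (suc n)) _) (cong (n * V (suc n) *_) (∑-*ʳ units k singular)) ⟩
    n * V (suc n) * (∑ units singular * k)
      ≤⟨ *-monoʳ-≤ (n * V (suc n)) (≤-trans (*-monoˡ-≤ k singular-total) (UBZk-bound n)) ⟩
    n * V (suc n) * (n * V (suc n))
      ≡⟨ square-* n (V (suc n)) ⟩
    n * n * (V (suc n) * V (suc n)) ∎
    where
    open ≤-Reasoning
    open Step n
    regroup : ∀ k s → k * k * k * (s * s) ≡ s * (k * k) * (s * k)
    regroup = solve-∀
    square-* : ∀ n v → n * v * (n * v) ≡ n * n * (v * v)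
    square-* = solve-∀

  regular-squares′ : ∀ n → q * ∑[ t ∈ units ] (Step.regular n t * Step.regular n t) ≤
                           2 * (k ^ suc n * k ^ suc n * (q ^ suc n * W n)) + 4 * (V (suc n) * V (suc n))
  regular-squares′ n = *-cancelˡ-≤ q (begin
    q * (q * X′)
      ≡⟨ sym (*-assoc q q X′) ⟩
    q * q * X′
      ≤⟨ regular-squares ⟩
    2 * (U * (k * (q * q ^ suc n * collisions) + q * (L * L))) + q * (2 * (U * L * (U * L)))
      ≡⟨ expand U k q (q ^ suc n) collisions L ⟩
    q * (2 * (U * k * (q ^ suc n * collisions)) + (2 * (U * (L * L)) + 2 * (U * U * (L * L))))
      ≤⟨ *-monoʳ-≤ q (+-mono-≤ (*-monoʳ-≤ 2 (*-monoʳ-≤ (U * k) (*-monoʳ-≤ (q ^ suc n) collisions-bound)))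
           (+-monoˡ-≤ _ (*-monoʳ-≤ 2 (*-monoˡ-≤ (L * L) U≤U²)))) ⟩
    q * (2 * (U * k * (q ^ suc n * (B * W n))) + (2 * (U * U * (L * L)) + 2 * (U * U * (L * L))))
      ≤⟨ *-monoʳ-≤ q (+-monoʳ-≤ (2 * (U * k * (q ^ suc n * (B * W n)))) (+-mono-≤ (*-monoʳ-≤ 2 (*-monoʳ-≤ (U * U) L²)) (*-monoʳ-≤ 2 (*-monoʳ-≤ (U * U) L²)))) ⟩
    q * (2 * (U * k * (q ^ suc n * (B * W n))) + (2 * (U * U * (B * V n * (B * V n))) + 2 * (U * U * (B * V n * (B * V n)))))
      ≡⟨ cong (q *_) (collect k B (q ^ suc n) (W n) (V n)) ⟩
    q * (2 * (U * U * (q ^ suc n * W n)) + 4 * (U * (B * V n) * (U * (B * V n))))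
      ≡⟨ cong (λ z → q * (2 * (U * U * (q ^ suc n * W n)) + 4 * (z * z))) (sym (V-suc n)) ⟩
    q * (2 * (U * U * (q ^ suc n * W n)) + 4 * (V (suc n) * V (suc n))) ∎)
    where
    open ≤-Reasoning
    open Step n hiding (W)
    X′ : ℕ
    X′ = ∑[ t ∈ units ] (regular t * regular t)
    -- Absorbs the contribution of the zero column into the main term.
    U≤U² : U ≤ U * U
    U≤U² = m≤m*n U U {{m^n≢0 k (suc n)}}
    L² : L * L ≤ B * V n * (B * V n)
    L² = *-mono-≤ L≤ L≤
      where
      L≤ : L ≤ B * V n
      L≤ = ≤-trans (m≤m+n L (B * Z)) (≤-reflexive L+Singular)
    expand : ∀ u k q p r l → 2 * (u * (k * (q * p * r) + q * (l * l))) + q * (2 * (u * l * (u * l))) ≡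
                             q * (2 * (u * k * (p * r)) + (2 * (u * (l * l)) + 2 * (u * u * (l * l))))
    expand = solve-∀
    collect : ∀ k b p w v → 2 * (k * b * k * (p * (b * w))) + (2 * (k * b * (k * b) * (b * v * (b * v))) + 2 * (k * b * (k * b) * (b * v * (b * v)))) ≡
                            2 * (k * b * (k * b) * (p * w)) + 4 * (k * b * (b * v) * (k * b * (b * v)))
    collect = solve-∀

  -- The scaling by `q * k` clears the denominators of the regular and the singular part at once.
  W-step : ∀ n → q * k * W (suc n) ≤ 4 * (k ^ suc n * k ^ suc n * q ^ n * (q * k * W n)) + (8 + 2 * (n * n)) * (k * (V (suc n) * V (suc n)))
  W-step n = begin
    q * k * W (suc n)
      ≤⟨ *-monoʳ-≤ (q * k) W-suc ⟩
    q * k * (2 * X′ + 2 * Y′)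
      ≡⟨ distribute q k X′ Y′ ⟩
    2 * k * (q * X′) + 2 * (q * k * Y′)
      ≤⟨ +-mono-≤ (*-monoʳ-≤ (2 * k) (regular-squares′ n)) (*-monoʳ-≤ 2 (singular-squares n)) ⟩
    2 * k * (2 * (U * U * (q * q ^ n * W n)) + 4 * (V′ * V′)) + 2 * (n * n * (V′ * V′))
      ≤⟨ +-monoʳ-≤ (2 * k * (2 * (U * U * (q * q ^ n * W n)) + 4 * (V′ * V′)))
           (*-monoʳ-≤ 2 (*-monoʳ-≤ (n * n) (m≤n*m (V′ * V′) k))) ⟩
    2 * k * (2 * (U * U * (q * q ^ n * W n)) + 4 * (V′ * V′)) + 2 * (n * n * (k * (V′ * V′)))
      ≡⟨ collect k q U (q ^ n) (W n) (V′ * V′) n ⟩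
    4 * (U * U * q ^ n * (q * k * W n)) + (8 + 2 * (n * n)) * (k * (V′ * V′)) ∎
    where
    open ≤-Reasoning
    open Step n hiding (W)
    V′ X′ Y′ : ℕ
    V′ = V (suc n)
    X′ = ∑[ t ∈ units ] (regular t * regular t)
    Y′ = ∑[ t ∈ units ] (singular t * singular t)
    distribute : ∀ q k x y → q * k * (2 * x + 2 * y) ≡ 2 * k * (q * x) + 2 * (q * k * y)
    distribute = solve-∀
    collect : ∀ k q u p w v n → 2 * k * (2 * (u * u * (q * p * w)) + 4 * v) + 2 * (n * n * (k * v)) ≡
                                4 * (u * u * p * (q * k * w)) + (8 + 2 * (n * n)) * (k * v)
    collect = solve-∀

  -- The induction starts here because at n = 0 the bound would read q k ≤ k + q. For 1 × 1 matrices
  -- maximum times total is enough.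
  W-one : q * k * W 1 ≤ bound 1 * (k * (V 1 * V 1) + q ^ suc (triangle 1) * (k ^ 1 * V 1))
  W-one = begin
    q * k * W 1                          ≡⟨ rotate q k (W 1) ⟩
    q * (W 1 * k)                        ≤⟨ *-monoʳ-≤ q W₁k ⟩
    q * (V 1 * V 1)                      ≡⟨ unit-powers q k ⟩
    q ^ 1 * (k ^ 1 * V 1)                ≤⟨ m≤n+m _ (k * (V 1 * V 1)) ⟩
    -- The literal 12 is the value of `bound 1`.
    k * (V 1 * V 1) + q ^ 1 * (k ^ 1 * V 1) ≤⟨ m≤n*m _ 12 ⟩
    12 * (k * (V 1 * V 1) + q ^ 1 * (k ^ 1 * V 1)) ∎
    where
    open ≤-Reasoning
    rotate : ∀ q k w → q * k * w ≡ q * (w * k)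
    rotate = solve-∀
    unit-powers : ∀ q k → q * (k * 1 * 1 * (k * 1 * 1)) ≡ q * 1 * (k * 1 * (k * 1 * 1))
    unit-powers = solve-∀
    W₁k : W 1 * k ≤ V 1 * V 1
    W₁k = begin
      W 1 * k                                   ≡⟨ sym (∑-*ʳ units k _) ⟩
      ∑[ t ∈ units ] (cnt 1 t * cnt 1 t * k)    ≤⟨ ∑-mono-∈ units (λ {t} i → ≤-trans (≤-reflexive (*-assoc (cnt 1 t) (cnt 1 t) k))
                                                     (*-monoʳ-≤ (cnt 1 t) (Step.cnt-bound 0 (∈-units i)))) ⟩
      ∑[ t ∈ units ] (cnt 1 t * V 1)            ≡⟨ ∑-*ʳ units (V 1) (cnt 1) ⟩
      ∑ units (cnt 1) * V 1                     ≤⟨ *-monoˡ-≤ (V 1) (Step.cnt-total 0) ⟩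
      V 1 * V 1                                 ∎

  -- Divided by `q * k`, the first term is the value V²/q of perfect equidistribution, and the
  -- second is the accumulated variance.
  W-bound : ∀ n → 1 ≤ n → q * k * W n ≤ bound n * (k * (V n * V n) + q ^ suc (triangle n) * (k ^ n * V n))
  W-bound (suc zero)    _ = W-one
  W-bound (suc n@(suc _)) _ = begin
    q * k * W (suc n)
      ≤⟨ W-step n ⟩
    4 * (U * U * q ^ n * (q * k * W n)) + c * (k * (V′ * V′))
      ≤⟨ +-monoˡ-≤ _ (*-monoʳ-≤ 4 (*-monoʳ-≤ (U * U * q ^ n) (W-bound n (s≤s z≤n)))) ⟩
    4 * (U * U * q ^ n * (b * (k * (V n * V n) + Q * (B * V n)))) + c * (k * (V′ * V′))
      ≡⟨ expand U (q ^ n) b k (V n) Q B c (V′ * V′) ⟩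
    4 * b * (k * (U * U * q ^ n * (V n * V n))) + 4 * b * (q ^ n * Q * (U * (U * (B * V n)))) + c * (k * (V′ * V′))
      -- Here q ≤ k² makes the equidistribution term reproduce itself: q^n is at most B².
      ≤⟨ +-monoˡ-≤ _ (+-monoˡ-≤ _ (*-monoʳ-≤ (4 * b) (*-monoʳ-≤ k (*-monoˡ-≤ (V n * V n) (*-monoʳ-≤ (U * U) qⁿ≤B²))))) ⟩
    4 * b * (k * (U * U * (B * B) * (V n * V n))) + 4 * b * (q ^ n * Q * (U * (U * (B * V n)))) + c * (k * (V′ * V′))
      ≡⟨ cong₂ (λ y z → 4 * b * (k * y) + 4 * b * (q ^ n * Q * (U * z)) + c * (k * (V′ * V′)))
           (trans (squares U B (V n)) (cong (λ z → z * z) (sym (V-suc n)))) (sym (V-suc n)) ⟩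
    4 * b * (k * (V′ * V′)) + 4 * b * (q ^ n * Q * (U * V′)) + c * (k * (V′ * V′))
      -- The missing product is added so that the right side factors.
      ≤⟨ m≤m+n _ (c * (q ^ n * Q * (U * V′))) ⟩
    4 * b * (k * (V′ * V′)) + 4 * b * (q ^ n * Q * (U * V′)) + c * (k * (V′ * V′)) + c * (q ^ n * Q * (U * V′))
      ≡⟨ collect (4 * b) c (k * (V′ * V′)) (q ^ n * Q * (U * V′)) ⟩
    (4 * b + c) * (k * (V′ * V′) + q ^ n * Q * (U * V′))
      ≡⟨ cong (λ z → (4 * b + c) * (k * (V′ * V′) + z * (U * V′))) (trans (sym (^-distribˡ-+-* q n (suc (triangle n)))) (cong (q ^_) (+-suc n (triangle n)))) ⟩
    bound (suc n) * (k * (V′ * V′) + q ^ suc (triangle (suc n)) * (U * V′)) ∎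
    where
    open ≤-Reasoning
    open Step n hiding (W)
    b c V′ Q : ℕ
    b = bound n
    c = 8 + 2 * (n * n)
    V′ = V (suc n)
    Q = q ^ suc (triangle n)
    qⁿ≤B² : q ^ n ≤ B * B
    qⁿ≤B² = ≤-trans (^-monoˡ-≤ n q≤k²) (≤-reflexive (^-distribʳ-* k k n))
    expand : ∀ u p b k v s e c x → 4 * (u * u * p * (b * (k * (v * v) + s * (e * v)))) + c * (k * x) ≡
                                   4 * b * (k * (u * u * p * (v * v))) + 4 * b * (p * s * (u * (u * (e * v)))) + c * (k * x)
    expand = solve-∀
    squares : ∀ u e v → u * u * (e * e) * (v * v) ≡ u * (e * v) * (u * (e * v))
    squares = solve-∀
    collect : ∀ b c x y → b * x + b * y + c * x + c * y ≡ (b + c) * (x + y)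
    collect = solve-∀

-- Consequences of the two thresholds

^-cancelˡ-≤ : ∀ e .{{_ : NonZero e}} {a b} → a ^ e ≤ b ^ e → a ≤ b
^-cancelˡ-≤ e le = ≮⇒≥ (λ b<a → <⇒≱ (^-monoˡ-< e b<a) le)

module Thresholds (K q k n : ℕ) {{_ : NonZero K}} {{_ : NonZero q}}
                  (first : K ^ suc (n + n) * q ^ suc n ≤ k ^ suc (n + n))
                  (second : K ^ (2 * (n * suc n + 2)) * q ^ (n * suc n + 4) ≤ k ^ (2 * (n * suc n + 2))) where
  open ≤-Reasoning

  -- With d = n + 1 these are 2d - 1, d² - d + 2 and half of d² - d + 4.
  e E f : ℕ
  e = suc (n + n)
  E = n * suc n + 2
  f = suc (n + suc (triangle n))

  K≤K^ : ∀ i .{{_ : NonZero i}} → K ≤ K ^ i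
  K≤K^ (suc i) = m≤m*n K (K ^ i) {{m^n≢0 K i}}

  K≤k : K ≤ k
  K≤k = ^-cancelˡ-≤ e (≤-trans (m≤m*n (K ^ e) (q ^ suc n) {{m^n≢0 q (suc n)}}) first)

  -- The exponent d/(2d - 1) exceeds 1/2: squaring `first` gives q^(2d), one power of q more than
  -- required.
  Kq≤k² : K * q ≤ k * k
  Kq≤k² = ^-cancelˡ-≤ e (begin
    (K * q) ^ e                                  ≡⟨ ^-distribʳ-* K q e ⟩
    K ^ e * q ^ e                                ≤⟨ *-mono-≤ (m≤m*n (K ^ e) (K ^ e) {{m^n≢0 K e}}) (^-monoʳ-≤ q (+-monoʳ-≤ (suc n) (n≤1+n n))) ⟩
    K ^ e * K ^ e * q ^ (suc n + suc n)          ≡⟨ cong (K ^ e * K ^ e *_) (^-distribˡ-+-* q (suc n) (suc n)) ⟩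
    K ^ e * K ^ e * (q ^ suc n * q ^ suc n)      ≡⟨ interchange (K ^ e) (q ^ suc n) ⟩
    K ^ e * q ^ suc n * (K ^ e * q ^ suc n)      ≤⟨ *-mono-≤ first first ⟩
    k ^ e * k ^ e                                ≡⟨ sym (^-distribʳ-* k k e) ⟩
    (k * k) ^ e                                  ∎)
    where
    interchange : ∀ a b → a * a * (b * b) ≡ a * b * (a * b)
    interchange = solve-∀

  first′ : K * q ^ suc n ≤ k * (k ^ n * k ^ n)
  first′ = begin
    K * q ^ suc n         ≤⟨ *-monoˡ-≤ (q ^ suc n) (K≤K^ e) ⟩
    K ^ e * q ^ suc n     ≤⟨ first ⟩
    k ^ e                 ≡⟨ cong (k *_) (^-distribˡ-+-* k n n) ⟩
    k * (k ^ n * k ^ n)   ∎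

  ^-double : ∀ a i → a ^ (2 * i) ≡ a ^ i * a ^ i
  ^-double a i = trans (cong (λ j → a ^ (i + j)) (+-identityʳ i)) (^-distribˡ-+-* a i i)

  -- Controls the second term of `W-bound`, as `first′` controls the first. The hypothesis has
  -- doubled exponents to stay integral, so a square root is taken.
  second′ : K * (q ^ suc n * q ^ suc (triangle n)) ≤ k * (k * k ^ n) * (k ^ n) ^ n
  second′ = begin
    K * (q ^ suc n * q ^ suc (triangle n))     ≡⟨ cong (K *_) (sym (^-distribˡ-+-* q (suc n) (suc (triangle n)))) ⟩
    K * q ^ f                                  ≤⟨ *-monoˡ-≤ (q ^ f) (K≤K^ E {{>-nonZero (≤-trans (s≤s z≤n) (m≤n+m 2 (n * suc n)))}}) ⟩
    K ^ E * q ^ f                              ≤⟨ square-mono⁻¹ squared ⟩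
    k ^ (n * suc n + 2)                        ≡⟨ ^-distribˡ-+-* k (n * suc n) 2 ⟩
    k ^ (n * suc n) * (k * (k * 1))            ≡⟨ cong (_* (k * (k * 1))) (sym (^-*-assoc k n (suc n))) ⟩
    k ^ n * (k ^ n) ^ n * (k * (k * 1))        ≡⟨ regroup k (k ^ n) ((k ^ n) ^ n) ⟩
    k * (k * k ^ n) * (k ^ n) ^ n              ∎
    where
    regroup : ∀ k b v → b * v * (k * (k * 1)) ≡ k * (k * b) * v
    regroup = solve-∀
    interchange : ∀ a b → a * b * (a * b) ≡ a * a * (b * b)
    interchange = solve-∀
    double : ∀ n t → 2 * suc (n + suc t) ≡ (2 * t + n) + n + 4
    double = solve-∀
    2*f : 2 * f ≡ n * suc n + 4
    2*f = trans (double n (triangle n)) (cong (_+ 4) (trans (cong (_+ n) (2*triangle n)) (trans (+-comm (n * n) n) (sym (*-suc n n)))))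
    squared : K ^ E * q ^ f * (K ^ E * q ^ f) ≤ k ^ E * k ^ E
    squared = begin
      K ^ E * q ^ f * (K ^ E * q ^ f)      ≡⟨ interchange (K ^ E) (q ^ f) ⟩
      K ^ E * K ^ E * (q ^ f * q ^ f)      ≡⟨ cong₂ _*_ (sym (^-double K E)) (trans (sym (^-double q f)) (cong (q ^_) 2*f)) ⟩
      K ^ (2 * E) * q ^ (n * suc n + 4)    ≤⟨ second ⟩
      k ^ (2 * E)                          ≡⟨ ^-double k E ⟩
      k ^ E * k ^ E                        ∎

-- Large enough to make each of three error terms at most |A|^(d²) / 3(m + 1), where d = n + 1.
threshold : ℕ → ℕ → ℕ
threshold n m = n * (2 * bound n * (3 * suc m * (3 * suc m)))

threshold-nonZero : ∀ n m → 1 ≤ n → NonZero (threshold n m)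
threshold-nonZero n m 1≤n = >-nonZero (*-mono-≤ 1≤n (*-mono-≤ (≤-trans (bound≥1 n) (m≤n*m (bound n) 2)) (*-mono-≤ 1≤M 1≤M)))
  where
  1≤M : 1 ≤ 3 * suc m
  1≤M = ≤-trans (s≤s z≤n) (m≤n*m (suc m) 3)

-- Error terms and conclusion

module Asymptotics (F : FiniteField) (odd : OddCharacteristic F) (A : Carrier F → Bool) (n m : ℕ) (1≤n : 1 ≤ n)
                   (first : threshold n m ^ suc (n + n) * FiniteField.size F ^ suc n ≤ card F A ^ suc (n + n))
                   (second : threshold n m ^ (2 * (n * suc n + 2)) * FiniteField.size F ^ (n * suc n + 4) ≤ card F A ^ (2 * (n * suc n + 2))) where
  open Field F
  open Matrices F odd A

  K M C : ℕ
  K = threshold n m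
  M = 3 * suc m
  C = bound n

  instance
    K-nonZero : NonZero K
    K-nonZero = threshold-nonZero n m 1≤n
    q-nonZero : NonZero q
    q-nonZero = >-nonZero (≤-<-trans z≤n (toℕ<n (Inverse.to enum 𝟘)))

  open Thresholds K q k n first second

  0<k : 0 < k
  0<k = ≤-trans (>-nonZero⁻¹ K) K≤k

  open Recursion F odd A 0<k (≤-trans (m≤n*m q K) Kq≤k²) hiding (W; q-nonZero)
  open Step n

  V′ : ℕ
  V′ = V (suc n)

  -- After squaring, the two terms of `W-bound` are matched by `first′` and `second′`, each giving C
  -- times the target. Hence the factor 2C in `threshold`, where M appears squared because the error
  -- does.
  regular-error : ∀ {t} → ¬ (t ≡ 𝟘) → M * ∣ q * regular t - U * L ∣ ≤ V′
  -- The factor k supplies the scaling `q * k` in which `W-bound` is stated.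
  regular-error {t} t≢0 = square-mono⁻¹ (*-cancelˡ-≤ (2 * C) {{2C-nonZero}} (*-cancelˡ-≤ k (begin
    k * (2 * C * (M * D * (M * D)))
      ≡⟨ regroup k C M D ⟩
    2 * C * (M * M) * (k * (D * D))
      ≤⟨ *-monoˡ-≤ (k * (D * D)) (m≤n*m _ n {{>-nonZero 1≤n}}) ⟩
    K * (k * (D * D))
      ≤⟨ *-monoʳ-≤ K (*-monoʳ-≤ k (≤-trans (regular-pointwise t≢0) (*-monoʳ-≤ U (*-monoʳ-≤ (q ^ suc (suc n)) collisions-bound)))) ⟩
    K * (k * (U * (q * q ^ suc n * (B * W))))
      ≡⟨ isolate K k U q (q ^ suc n) B W ⟩
    K * (U * B * q ^ suc n * (q * k * W))
      ≤⟨ *-monoʳ-≤ K (*-monoʳ-≤ (U * B * q ^ suc n) (W-bound n 1≤n)) ⟩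
    K * (U * B * q ^ suc n * (C * (k * (V n * V n) + q ^ suc (triangle n) * (B * V n))))
      ≡⟨ spread K U B (q ^ suc n) C k (V n) (q ^ suc (triangle n)) ⟩
    C * (U * B * k * (V n * V n) * (K * q ^ suc n)) + C * (U * B * B * V n * (K * (q ^ suc n * q ^ suc (triangle n))))
      ≤⟨ +-mono-≤ (*-monoʳ-≤ C (*-monoʳ-≤ (U * B * k * (V n * V n)) first′)) (*-monoʳ-≤ C (*-monoʳ-≤ (U * B * B * V n) second′)) ⟩
    C * (U * B * k * (V n * V n) * (k * (B * B))) + C * (U * B * B * V n * (k * U * V n))
      ≡⟨ gather C k B (V n) ⟩
    k * (2 * C * (U * (B * V n) * (U * (B * V n))))
      ≡⟨ cong (λ z → k * (2 * C * (z * z))) (sym (V-suc n)) ⟩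
    k * (2 * C * (V′ * V′)) ∎)))
    where
    D : ℕ
    D = ∣ q * regular t - U * L ∣
    2C-nonZero : NonZero (2 * C)
    2C-nonZero = >-nonZero (≤-trans (bound≥1 n) (m≤n*m C 2))
    open ≤-Reasoning
    regroup : ∀ k c m d → k * (2 * c * (m * d * (m * d))) ≡ 2 * c * (m * m) * (k * (d * d))
    regroup = solve-∀
    isolate : ∀ x k u q p b w → x * (k * (u * (q * p * (b * w)))) ≡ x * (u * b * p * (q * k * w))
    isolate = solve-∀
    spread : ∀ x u b p c k v s → x * (u * b * p * (c * (k * (v * v) + s * (b * v)))) ≡
                                 c * (u * b * k * (v * v) * (x * p)) + c * (u * b * b * v * (x * (p * s)))
    spread = solve-∀
    gather : ∀ c k b v → c * (k * b * b * k * (v * v) * (k * (b * b))) + c * (k * b * b * b * v * (k * (k * b) * v)) ≡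
                         k * (2 * c * (k * b * (b * v) * (k * b * (b * v))))
    gather = solve-∀

  -- The factor n of `threshold` cancels the n lost in `zero-det-bound`; what is left is at least M.
  M-from-K : ∀ {x} → K * x ≤ n * V′ → M * x ≤ V′
  M-from-K {x} le = ≤-trans (*-monoˡ-≤ x M≤)
    (*-cancelˡ-≤ n {{>-nonZero 1≤n}} (≤-trans (≤-reflexive (sym (*-assoc n _ x))) le))
    where
    M≤ : M ≤ 2 * C * (M * M)
    M≤ = ≤-trans (m≤m*n M M) (m≤n*m (M * M) (2 * C) {{>-nonZero (≤-trans (bound≥1 n) (m≤n*m C 2))}})

  singular-error : ∀ {t} → ¬ (t ≡ 𝟘) → M * (q * singular t) ≤ V′
  singular-error {t} t≢0 = M-from-K (begin
    K * (q * singular t)    ≡⟨ trans (sym (*-assoc K q (singular t))) (*-comm (K * q) (singular t)) ⟩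
    singular t * (K * q)    ≤⟨ *-monoʳ-≤ (singular t) Kq≤k² ⟩
    singular t * (k * k)    ≤⟨ singular-pointwise n t≢0 ⟩
    n * V′                  ∎)
    where open ≤-Reasoning

  -- The regular part concentrates around `U * L` rather than `V′`; by `L+Singular` this is the gap.
  missing-error : M * (U * (B * Z)) ≤ V′
  missing-error = M-from-K (begin
    K * (U * (B * Z))       ≤⟨ *-monoˡ-≤ (U * (B * Z)) K≤k ⟩
    k * (U * (B * Z))       ≡⟨ *-comm k (U * (B * Z)) ⟩
    U * (B * Z) * k         ≤⟨ UBZk-bound n ⟩
    n * V′                  ∎)
    where open ≤-Reasoning

  cnt-asymptotics : ∀ {t} → ¬ (t ≡ 𝟘) → suc m * ∣ q * cnt (suc n) t - V′ ∣ ≤ V′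
  cnt-asymptotics {t} t≢0 = *-cancelˡ-≤ 3 (begin
    3 * (suc m * ∣ q * cnt (suc n) t - V′ ∣)
      ≡⟨ sym (*-assoc 3 (suc m) _) ⟩
    M * ∣ q * cnt (suc n) t - V′ ∣
      ≡⟨ cong (M *_) (cong₂ ∣_-_∣ (trans (cong (q *_) (cnt-partition t)) (*-distribˡ-+ q (regular t) (singular t)))
           (trans (V-suc n) (trans (cong (U *_) (sym L+Singular)) (*-distribˡ-+ U L (B * Z))))) ⟩
    M * ∣ q * regular t + q * singular t - U * L + U * (B * Z) ∣
      ≤⟨ *-monoʳ-≤ M (≤-trans (dist-+ (q * regular t) (q * singular t) (U * L) (U * (B * Z)))
           (+-monoʳ-≤ D (≤-trans (∣m-n∣≤m⊔n (q * singular t) (U * (B * Z))) (m⊔n≤m+n (q * singular t) (U * (B * Z)))))) ⟩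
    M * (D + (q * singular t + U * (B * Z)))
      ≡⟨ trans (*-distribˡ-+ M D _) (cong (M * D +_) (*-distribˡ-+ M (q * singular t) (U * (B * Z)))) ⟩
    M * D + (M * (q * singular t) + M * (U * (B * Z)))
      ≤⟨ +-mono-≤ (regular-error t≢0) (+-mono-≤ (singular-error t≢0) missing-error) ⟩
    V′ + (V′ + V′)
      ≡⟨ triple V′ ⟩
    3 * V′ ∎)
    where
    open ≤-Reasoning
    D : ℕ
    D = ∣ q * regular t - U * L ∣
    triple : ∀ v → v + (v + v) ≡ 3 * v
    triple = solve-∀

-- The asymptotics with explicit quantifiers: the relative error is 1/(m + 1), and K, depending on d
-- and m only, is the factor by which |A| must exceed each of the two powers of q. Raising to the
-- denominators of the exponents keeps the conditions in ℕ.
theorem4 : (d : ℕ) → 2 ≤ d → (m : ℕ) → ∃[ K ] ((F : FiniteField) → OddCharacteristic F →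
    (t : Carrier F) → ¬ (t ≡ 0# F) → (A : Carrier F → Bool) →
    K ^ (2 * d ∸ 1) * size F ^ d ≤ card F A ^ (2 * d ∸ 1) →
    K ^ (2 * (d * d ∸ d + 2)) * size F ^ (d * d ∸ d + 4) ≤ card F A ^ (2 * (d * d ∸ d + 2)) →
    suc m * ∣ size F * N F d A t - card F A ^ (d * d) ∣ ≤ card F A ^ (d * d))
theorem4 (suc zero) (s≤s ()) m
theorem4 (suc n@(suc _)) _ m = threshold n m , λ F odd t t≢0 A first second →
  let open Asymptotics F odd A n m (s≤s z≤n)
        (subst (λ e → threshold n m ^ e * size F ^ suc n ≤ card F A ^ e) exponent₁ first)
        (subst (λ e → threshold n m ^ (2 * (e + 2)) * size F ^ (e + 4) ≤ card F A ^ (2 * (e + 2))) exponent₂ second)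
  in subst₂ (λ c v → suc m * ∣ size F * c - v ∣ ≤ v)
       (sym (Matrices.N-cnt F odd A (suc n) t)) (^-*-assoc (card F A) (suc n) (suc n)) (cnt-asymptotics t≢0)
  where
  exponent₁ : 2 * suc n ∸ 1 ≡ suc (n + n)
  exponent₁ = trans (+-suc n (n + 0)) (cong (λ z → suc (n + z)) (+-identityʳ n))
  exponent₂ : suc n * suc n ∸ suc n ≡ n * suc n
  exponent₂ = m+n∸m≡n (suc n) (n * suc n)
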